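{- Let $f$ be a convex function with $f(0)=0$ that is strictly increasing on $\mathbb{R}^+$, and for a connected graph $G$ let $\mathrm{W}_f(G)=\sum_{\{u,v\}\subset V(G)} f(d(u,v))$. If $G$ is a connected graph of order $n$ with independence number $\alpha$ satisfying $n-1\ge\alpha\ge\frac n2$, then $\mathrm{W}_f(G)\le\mathrm{W}_f(\mathcal{A}_{n,n-\alpha})$, with equality if and only if $G\cong\mathcal{A}_{n,n-\alpha}$.
   Context: $d(u,v)$ is the graph distance and the sum runs over unordered pairs of distinct vertices. The independence number is the size of a largest independent vertex set. For integers $n,m$, $\mathcal{A}_{n,m}$ is the tree obtained from a path on $2m-1$ vertices by attaching $\lceil \frac{n-2m+1}{2}\rceil$ new pendent vertices to one end vertex of the path and $\lfloor \frac{n-2m+1}{2}\rfloor$ new pendent vertices to the other end vertex (for $n=2m$ it is the path on $2m$ vertices).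
   Formalization: The function f is given only by its values at the natural numbers (all that W_f depends on), and these values are rational instead of real; convexity and strict increase are stated for this sequence. -}

module Defs where

open import Data.Nat using (ℕ; zero; suc; _+_; _∸_; _*_; _/_; _≡ᵇ_; _<ᵇ_; _≤ᵇ_)
open import Data.Bool using (Bool; true; false; _∧_; _∨_; if_then_else_; not)
open import Data.Fin using (Fin; toℕ; _≟_)
open import Data.Fin.Subset using (Subset; _∈_; ∣_∣)
open import Data.List using (List; allFin; map; concatMap; foldr)
open import Data.Bool.ListAction using (any)
open import Data.Bool.Properties using (∨-comm)
open import Data.Product using (Σ; ∃; _×_; _,_)
open import Data.Rational using (ℚ; 0ℚ) renaming (_+_ to _+ℚ_)
open import Relation.Nullary.Decidable using (⌊_⌋)
open import Relation.Binary.PropositionalEquality using (_≡_; refl; cong₂)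
open import Relation.Nullary using (¬_)
open import Function.Bundles using (_↔_; Inverse)

record Graph (n : ℕ) : Set where
  field
    adj    : Fin n → Fin n → Bool
    sym    : ∀ i j → adj i j ≡ adj j i
    irrefl : ∀ i → adj i i ≡ false
open Graph public

reach : ∀ {n} → Graph n → ℕ → Fin n → Fin n → Bool
reach G zero    u v = ⌊ u ≟ v ⌋
reach G (suc k) u v = reach G k u v ∨ any (λ w → adj G u w ∧ reach G k w v) (allFin _)

Connected : ∀ {n} → Graph n → Set
Connected G = ∀ u v → ∃ λ k → reach G k u v ≡ true

searchFrom : (ℕ → Bool) → ℕ → ℕ → ℕ
searchFrom p start zero       = start
searchFrom p start (suc fuel) = if p start then start else searchFrom p (suc start) fuel

-- graph distance: the least k with a walk of length ≤ k from u to v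
-- (in a connected graph on n vertices it is < n, so searching k = 0 … n suffices)
dist : ∀ {n} → Graph n → Fin n → Fin n → ℕ
dist {n} G u v = searchFrom (λ k → reach G k u v) 0 n

sumℚ : List ℚ → ℚ
sumℚ = foldr _+ℚ_ 0ℚ

Wf : ∀ {n} → (ℕ → ℚ) → Graph n → ℚ
Wf {n} f G =
  sumℚ (concatMap (λ u → concatMap (λ v →
          if toℕ u <ᵇ toℕ v then (f (dist G u v) Data.List.∷ Data.List.[]) else Data.List.[])
        (allFin n)) (allFin n))

Independent : ∀ {n} → Graph n → Subset n → Set
Independent G S = ∀ u v → u ∈ S → v ∈ S → adj G u v ≡ false

IndependenceNumber : ∀ {n} → Graph n → ℕ → Set
IndependenceNumber {n} G α =
  (Σ (Subset n) λ S → Independent G S × ∣ S ∣ ≡ α) ×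
  (∀ (S : Subset n) → Independent G S → ∣ S ∣ Data.Nat.≤ α)

_≅_ : ∀ {n} → Graph n → Graph n → Set
_≅_ {n} G H = Σ (Fin n ↔ Fin n) λ φ → ∀ u v → adj G u v ≡ adj H (Inverse.to φ u) (Inverse.to φ v)

-- The tree A_{n,m}, on vertices 0 … n-1:
--   path 0 - 1 - … - (2m-2) on 2m-1 vertices;
--   vertices 2m-1 … 2m-2+c are pendent at vertex 0, where c = ⌈(n-2m+1)/2⌉ = (n-2m+2)/2;
--   vertices 2m-1+c … n-1 (⌊(n-2m+1)/2⌋ of them) are pendent at vertex 2m-2.
-- edgeA n m i j: the edge {i,j} with i < j.
edgeA : ℕ → ℕ → ℕ → ℕ → Bool
edgeA n m i j =
  let e = 2 * m ∸ 2                      -- last path vertex 2m-2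
      c = (n + 2 ∸ 2 * m) / 2           -- ⌈(n-2m+1)/2⌉
  in  ((suc i ≡ᵇ j) ∧ (j ≤ᵇ e))
    ∨ ((e <ᵇ j) ∧ (j <ᵇ suc e + c) ∧ (i ≡ᵇ 0))
    ∨ ((suc e + c ≤ᵇ j) ∧ (i ≡ᵇ e))

-- (the guard `not (i ≡ᵇ j)` is redundant, since edgeA n m i i is always false;
-- it only makes irreflexivity immediate)
adjA : ℕ → ℕ → ℕ → ℕ → Bool
adjA n m i j = not (i ≡ᵇ j) ∧ (edgeA n m i j ∨ edgeA n m j i)

≡ᵇ-refl : ∀ i → (i ≡ᵇ i) ≡ true
≡ᵇ-refl zero    = refl
≡ᵇ-refl (suc i) = ≡ᵇ-refl i

≡ᵇ-sym : ∀ i j → (i ≡ᵇ j) ≡ (j ≡ᵇ i)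
≡ᵇ-sym zero    zero    = refl
≡ᵇ-sym zero    (suc j) = refl
≡ᵇ-sym (suc i) zero    = refl
≡ᵇ-sym (suc i) (suc j) = ≡ᵇ-sym i j

adjA-sym : ∀ n m i j → adjA n m i j ≡ adjA n m j i
adjA-sym n m i j = cong₂ (λ a b → not a ∧ b) (≡ᵇ-sym i j) (∨-comm (edgeA n m i j) (edgeA n m j i))

adjA-irrefl : ∀ n m i → adjA n m i i ≡ false
adjA-irrefl n m i rewrite ≡ᵇ-refl i = refl

𝒜 : (n m : ℕ) → Graph n
𝒜 n m = record
  { adj    = λ i j → adjA n m (toℕ i) (toℕ j)
  ; sym    = λ i j → adjA-sym n m (toℕ i) (toℕ j)
  ; irrefl = λ i → adjA-irrefl n m (toℕ i)
  }

{-# OPTIONS --safe #-}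

-- Put m = n ∸ α and k = 2m − 1. The complement of an independent set of size α is a vertex cover
-- of size m; as G is connected, the cover extends to a connected dominating set K of size k.
-- Let O be the set of the remaining L = n − k vertices, each of which has a neighbour in K.
--  * The distances from a vertex outside a connected set with j vertices but adjacent to it are,
--    after sorting, at most 1, …, j. This bounds the contribution of K × K and of K × O.
--  * For o, o′ ∈ O we have d(o, o′) ≤ 2 + t(o, o′), where t counts the edges of a spanning tree of K
--    separating their neighbours. Each of the k − 1 edges separates at most ⌈L/2⌉ ⌊L/2⌋ pairs, and
--    f lies below its chord on [2, k + 1], so the sum over O × O is at most that of a balanced
--    double broom.
-- All bounds are attained by 𝒜. If they are attained by G, the distances from each o ∈ O to K are
-- exactly 1, …, k, which forces K to be an induced path with O attached to its ends; the sum
-- over O × O then forces O to be independent and evenly split between the two ends.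
module Submission where

open import Defs
open import Data.Nat using (ℕ; zero; suc; _∸_; _≤_; _*_)
open import Data.Rational using (ℚ; 0ℚ; _+_; _<_)
open import Data.Product using (_×_; _,_; ∃; proj₁; proj₂)
open import Relation.Binary.PropositionalEquality as ≡ using (_≡_; _≢_; refl; cong; cong₂; subst)
open import Function.Bundles using (_⇔_; mk⇔; _↔_; Inverse)
import Data.Rational as Q

open import Algebra.Bundles using (CommutativeMonoid)
open import Data.Bool as Bool using (Bool; true; false; _∧_; _∨_; _xor_; not; if_then_else_)
open import Data.Bool.ListAction using (any)
open import Data.Bool.Properties using (⇔→≡; ∨-zeroʳ; xor-same; not-injective)
open import Data.Fin as Fin using (Fin; toℕ)
import Data.Fin.Permutation as FinPerm
open import Data.Fin.Properties using (toℕ-injective; any?; cast-involutive)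
open import Data.Fin.Subset using (Subset; ∣_∣)
open import Data.List using (List; []; _∷_; _++_; map; length; concatMap; replicate; downFrom; upTo; allFin; filter)
import Data.List.Membership.DecPropositional as DecMembership
open import Data.List.Membership.Propositional using (_∈_; _∉_)
open import Data.List.Membership.Propositional.Properties using (∈-allFin; ∈-map⁺; ∈-map⁻; ∈-filter⁺; ∈-filter⁻; ∈-++⁺ˡ; ∈-++⁺ʳ; ∈-++⁻; ∈-downFrom⁺; ∈-downFrom⁻)
open import Data.List.Membership.Propositional.Properties.WithK using (unique∧set⇒bag)
open import Data.List.Properties using (map-∘; map-++; map-replicate; map-tabulate; length-map; length-++; length-replicate; length-tabulate; lookup-tabulate; reverse-upTo; ++-assoc; ++-identityʳ)
open import Data.List.Relation.Binary.BagAndSetEquality using (∼bag⇒↭)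
open import Data.List.Relation.Binary.Permutation.Homogeneous using (onIndices)
open import Data.List.Relation.Binary.Permutation.Propositional as Perm using (_↭_; ↭-refl; ↭-sym; ↭-trans; ↭-prep; ↭-reflexive)
open import Data.List.Relation.Binary.Permutation.Propositional.Properties using (map⁺; ++⁺; ++⁺ˡ; ++⁺ʳ; ++-comm; shift; ↭-length; ↭-reverse; ∈-resp-↭)
import Data.List.Relation.Binary.Permutation.Setoid.Properties as SetoidPermₚ
open import Data.List.Relation.Unary.All as All using ([]; _∷_)
open import Data.List.Relation.Unary.All.Properties using (¬Any⇒All¬)
open import Data.List.Relation.Unary.AllPairs using ([]; _∷_)
open import Data.List.Relation.Unary.Any using (here; there)
open import Data.List.Relation.Unary.Unique.Propositional using (Unique)
import Data.List.Relation.Unary.Unique.Propositional.Properties as Unique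
import Data.Nat as ℕ
open import Data.Nat.DivMod using (m≡m%n+[m/n]*n; m%n<n)
import Data.Nat.Properties as ℕₚ
import Data.Rational.Properties as ℚₚ
open import Data.Sum using (_⊎_; inj₁; inj₂)
open import Data.Vec using (lookup; []; _∷_)
open import Data.Vec.Properties using (lookup⇒[]=)
open import Function using (_∘_; id)
open import Relation.Binary.Definitions using (tri<; tri≈; tri>)
open import Relation.Nullary using (¬_; Dec; yes; no; contradiction)
open import Relation.Nullary.Decidable using (does; dec-true; dec-false; ¬?; _×-dec_; decidable-stable)

open import Algebra.Properties.CommutativeMonoid.Mult ℚₚ.+-0-commutativeMonoid using (×-homo-+; ×-assocˡ; ×-distrib-+) renaming (_×_ to _·_)
open import Algebra.Properties.CommutativeSemigroup (CommutativeMonoid.commutativeSemigroup ℚₚ.+-0-commutativeMonoid) using (interchange; x∙yz≈y∙xz)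

-- Two outer vertices can be at distance k + 1, but in general not all pairs at once, and around an
-- arbitrary K there are no two sides to count. Counting spanning-tree edges replaces the question
-- by one independent problem per edge, solved by the balanced split. The chord makes the charge
-- linear in the number of separating edges and is exact at 2 and k + 1, the only distances between
-- leaves of 𝒜. The size 2m - 1 is the cost of connecting the cover: starting from one cover vertex,
-- each further one needs at most one extra vertex in between. For equality the averaged estimate
-- says little about single pairs. The distances from O to K are therefore settled before O × O:
-- they provide one explicit cut, left against right, and with it a bound for every pair separately.

private variable
  A B : Set

-- Sums over lists

∑ : List A → (A → ℚ) → ℚ
∑ []       g = 0ℚ
∑ (x ∷ xs) g = g x + ∑ xs g

∑-++ : ∀ (xs : List A) {ys} g → ∑ (xs ++ ys) g ≡ ∑ xs g + ∑ ys g
∑-++ []       g = ≡.sym (ℚₚ.+-identityˡ _)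
∑-++ (x ∷ xs) g = ≡.trans (cong (g x +_) (∑-++ xs g)) (≡.sym (ℚₚ.+-assoc (g x) _ _))

∑-map : ∀ (h : A → B) xs g → ∑ (map h xs) g ≡ ∑ xs (g ∘ h)
∑-map h []       g = refl
∑-map h (x ∷ xs) g = cong (g (h x) +_) (∑-map h xs g)

∑-cong : ∀ (xs : List A) {g h} → (∀ {x} → x ∈ xs → g x ≡ h x) → ∑ xs g ≡ ∑ xs h
∑-cong []       g≡h = refl
∑-cong (x ∷ xs) g≡h = cong₂ _+_ (g≡h (here refl)) (∑-cong xs (g≡h ∘ there))

∑-mono : ∀ (xs : List A) {g h} → (∀ {x} → x ∈ xs → g x Q.≤ h x) → ∑ xs g Q.≤ ∑ xs h
∑-mono []       g≤h = ℚₚ.≤-refl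
∑-mono (x ∷ xs) g≤h = ℚₚ.+-mono-≤ (g≤h (here refl)) (∑-mono xs (g≤h ∘ there))

∑-+ : ∀ (xs : List A) g h → ∑ xs (λ x → g x + h x) ≡ ∑ xs g + ∑ xs h
∑-+ []       g h = refl
∑-+ (x ∷ xs) g h = ≡.trans (cong (g x + h x +_) (∑-+ xs g h)) (interchange (g x) (h x) _ _)

∑-const : ∀ (xs : List A) q → ∑ xs (λ _ → q) ≡ length xs · q
∑-const []       q = refl
∑-const (x ∷ xs) q = cong (q +_) (∑-const xs q)

∑-swap : ∀ (xs : List A) (ys : List B) (g : A → B → ℚ) → ∑ xs (λ x → ∑ ys (g x)) ≡ ∑ ys (λ y → ∑ xs (λ x → g x y))
∑-swap []       []       g = refl
∑-swap []       (y ∷ ys) g = ≡.trans (∑-swap [] ys g) (≡.sym (ℚₚ.+-identityˡ _))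
∑-swap (x ∷ xs) ys       g =
  ≡.trans (cong (∑ ys (g x) +_) (∑-swap xs ys g)) (≡.sym (∑-+ ys (g x) (λ y → ∑ xs (λ x → g x y))))

∑-· : ∀ n (xs : List A) g → ∑ xs (λ x → n · g x) ≡ n · ∑ xs g
∑-· zero    []       g = refl
∑-· (suc n) []       g = ≡.trans (∑-· n [] g) (≡.sym (ℚₚ.+-identityˡ _))
∑-· n       (x ∷ xs) g = ≡.trans (cong (n · g x +_) (∑-· n xs g)) (≡.sym (×-distrib-+ (g x) _ n))

∑-↭ : ∀ {xs ys : List A} g → xs ↭ ys → ∑ xs g ≡ ∑ ys g
∑-↭ g Perm.refl          = refl
∑-↭ g (Perm.prep x σ)    = cong (g x +_) (∑-↭ g σ)
∑-↭ g (Perm.swap x y σ)  = ≡.trans (x∙yz≈y∙xz (g x) (g y) _) (cong (λ s → g y + (g x + s)) (∑-↭ g σ))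
∑-↭ g (Perm.trans σ τ)   = ≡.trans (∑-↭ g σ) (∑-↭ g τ)

<⇒≱ : ∀ {p q} → p < q → ¬ q Q.≤ p
<⇒≱ p<q q≤p = ℚₚ.<-irrefl refl (ℚₚ.<-≤-trans p<q q≤p)

≤-rigid : ∀ {p q} → p Q.≤ q → ¬ p < q → p ≡ q
≤-rigid p≤q p≮q = ℚₚ.≤-antisym p≤q (ℚₚ.≮⇒≥ p≮q)

-- Slack in one summand would survive in the sum. The whole equality case runs on this pattern: an
-- upper bound for each part, together with the reverse inequality for the sums, makes each part
-- tight.
+-rigidˡ : ∀ {p q r s} → p Q.≤ r → q Q.≤ s → r + s Q.≤ p + q → p ≡ r
+-rigidˡ p≤r q≤s r+s≤p+q =
  ≤-rigid p≤r λ p<r → <⇒≱ (ℚₚ.+-mono-<-≤ p<r q≤s) r+s≤p+q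

+-rigidʳ : ∀ {p q r s} → p Q.≤ r → q Q.≤ s → r + s Q.≤ p + q → q ≡ s
+-rigidʳ p≤r q≤s r+s≤p+q =
  ≤-rigid q≤s λ q<s → <⇒≱ (ℚₚ.+-mono-≤-< p≤r q<s) r+s≤p+q

∑-rigid : ∀ (xs : List A) {g h} → (∀ {x} → x ∈ xs → g x Q.≤ h x) → ∑ xs h Q.≤ ∑ xs g →
          ∀ {x} → x ∈ xs → g x ≡ h x
∑-rigid (x ∷ xs) g≤h h≤g (here refl) = +-rigidˡ (g≤h (here refl)) (∑-mono xs (g≤h ∘ there)) h≤g
∑-rigid (x ∷ xs) g≤h h≤g (there y∈) =
  ∑-rigid xs (g≤h ∘ there)
    (ℚₚ.≤-reflexive (≡.sym (+-rigidʳ (g≤h (here refl)) (∑-mono xs (g≤h ∘ there)) h≤g))) y∈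

double-cancel-≤ : ∀ {p q} → p + p Q.≤ q + q → p Q.≤ q
double-cancel-≤ pp≤qq = ℚₚ.≮⇒≥ λ q<p → <⇒≱ (ℚₚ.+-mono-< q<p q<p) pp≤qq

+-cancelʳ-≤ : ∀ {p q} r → p + r Q.≤ q + r → p Q.≤ q
+-cancelʳ-≤ r p+r≤q+r = ℚₚ.≮⇒≥ λ q<p → <⇒≱ (ℚₚ.+-monoˡ-< r q<p) p+r≤q+r

difference : ∀ p q → q ≡ p + (q Q.- p)
difference = solve 2 (λ p q → q := p :+ (q :+ (:- p))) refl
  where
  open import Data.Rational.Solver using (module +-*-Solver)
  open +-*-Solver

-- Natural multiples and chords of convex functions

·-monoʳ-≤ : ∀ n {p q} → p Q.≤ q → n · p Q.≤ n · q
·-monoʳ-≤ zero    p≤q = ℚₚ.≤-refl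
·-monoʳ-≤ (suc n) p≤q = ℚₚ.+-mono-≤ p≤q (·-monoʳ-≤ n p≤q)

·-monoʳ-< : ∀ n {p q} → p < q → suc n · p < suc n · q
·-monoʳ-< n p<q = ℚₚ.+-mono-<-≤ p<q (·-monoʳ-≤ n (ℚₚ.<⇒≤ p<q))

·-cancelˡ-≤ : ∀ n {p q} → suc n · p Q.≤ suc n · q → p Q.≤ q
·-cancelˡ-≤ n np≤nq = ℚₚ.≮⇒≥ λ q<p → <⇒≱ (·-monoʳ-< n q<p) np≤nq

·-nonneg : ∀ n {p} → 0ℚ Q.≤ p → 0ℚ Q.≤ n · p
·-nonneg zero    0≤p = ℚₚ.≤-refl
·-nonneg (suc n) 0≤p = ℚₚ.+-mono-≤ 0≤p (·-nonneg n 0≤p)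

·-monoˡ-≤ : ∀ {m n p} → 0ℚ Q.≤ p → m ≤ n → m · p Q.≤ n · p
·-monoˡ-≤ {n = n} 0≤p ℕ.z≤n       = ·-nonneg n 0≤p
·-monoˡ-≤ {p = p} 0≤p (ℕ.s≤s m≤n) = ℚₚ.+-monoʳ-≤ p (·-monoˡ-≤ 0≤p m≤n)

·-cancelʳ-≤ : ∀ m n {p} → 0ℚ < p → m · p Q.≤ n · p → m ≤ n
·-cancelʳ-≤ m n {p} 0<p mp≤np = ℕₚ.≮⇒≥ λ n<m → <⇒≱
  (ℚₚ.<-≤-trans (subst (_< suc n · p) (ℚₚ.+-identityˡ (n · p)) (ℚₚ.+-monoˡ-< (n · p) 0<p))
                (·-monoˡ-≤ (ℚₚ.<⇒≤ 0<p) n<m))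
  mp≤np

·-comm : ∀ m n p → m · (n · p) ≡ n · (m · p)
·-comm m n p = ≡.trans (×-assocˡ p m n) (≡.trans (cong (_· p) (ℕₚ.*-comm m n)) (≡.sym (×-assocˡ p n m)))

-- The first t increments are at most δ t and the next s are at least δ t, so h t ≤ t · δ t and h t
-- + s · δ t ≤ h (t + s). Eliminating δ t compares the slopes from the origin; the multiplied form
-- avoids division and admits t = 0.
chord : ∀ (h δ : ℕ → ℚ) → h 0 ≡ 0ℚ → (∀ i → h (suc i) ≡ h i + δ i) → (∀ i → δ i Q.≤ δ (suc i)) →
        ∀ t s → (t ℕ.+ s) · h t Q.≤ t · h (t ℕ.+ s)
chord h δ h0 h+ δ-mono t s = begin
  (t ℕ.+ s) · h t              ≡⟨ ×-homo-+ (h t) t s ⟩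
  t · h t + s · h t            ≤⟨ ℚₚ.+-monoʳ-≤ (t · h t) (·-monoʳ-≤ s (below t)) ⟩
  t · h t + s · (t · δ t)      ≡⟨ cong (t · h t +_) (·-comm s t (δ t)) ⟩
  t · h t + t · (s · δ t)      ≡⟨ ×-distrib-+ (h t) (s · δ t) t ⟨
  t · (h t + s · δ t)          ≤⟨ ·-monoʳ-≤ t (above s) ⟩
  t · h (t ℕ.+ s)              ∎
  where
  open ℚₚ.≤-Reasoning
  below : ∀ t → h t Q.≤ t · δ t
  below zero    = ℚₚ.≤-reflexive h0
  below (suc t) = begin
    h (suc t)               ≡⟨ h+ t ⟩
    h t + δ t               ≤⟨ ℚₚ.+-monoˡ-≤ (δ t) (below t) ⟩
    t · δ t + δ t           ≡⟨ ℚₚ.+-comm (t · δ t) (δ t) ⟩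
    suc t · δ t             ≤⟨ ·-monoʳ-≤ (suc t) (δ-mono t) ⟩
    suc t · δ (suc t)       ∎
  δ-mono+ : ∀ s → δ t Q.≤ δ (t ℕ.+ s)
  δ-mono+ zero    = ℚₚ.≤-reflexive (cong δ (≡.sym (ℕₚ.+-identityʳ t)))
  δ-mono+ (suc s) = ℚₚ.≤-trans (δ-mono+ s)
    (ℚₚ.≤-trans (δ-mono (t ℕ.+ s)) (ℚₚ.≤-reflexive (cong δ (≡.sym (ℕₚ.+-suc t s)))))
  above : ∀ s → h t + s · δ t Q.≤ h (t ℕ.+ s)
  above zero    = ℚₚ.≤-reflexive (≡.trans (ℚₚ.+-identityʳ (h t)) (cong h (≡.sym (ℕₚ.+-identityʳ t))))
  above (suc s) = begin
    h t + (δ t + s · δ t)         ≡⟨ cong (h t +_) (ℚₚ.+-comm (δ t) (s · δ t)) ⟩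
    h t + (s · δ t + δ t)         ≡⟨ ℚₚ.+-assoc (h t) (s · δ t) (δ t) ⟨
    h t + s · δ t + δ t           ≤⟨ ℚₚ.+-mono-≤ (above s) (δ-mono+ s) ⟩
    h (t ℕ.+ s) + δ (t ℕ.+ s)     ≡⟨ h+ (t ℕ.+ s) ⟨
    h (suc (t ℕ.+ s))             ≡⟨ cong h (ℕₚ.+-suc t s) ⟨
    h (t ℕ.+ suc s)               ∎

-- Counting separated pairs

count : (A → Bool) → List A → ℕ
count c []       = 0
count c (x ∷ xs) = if c x then suc (count c xs) else count c xs

count-not : ∀ (c : A → Bool) xs → count c xs ℕ.+ count (not ∘ c) xs ≡ length xs
count-not c []       = refl
count-not c (x ∷ xs) with c x
... | true  = cong suc (count-not c xs)
... | false = ≡.trans (ℕₚ.+-suc _ _) (cong suc (count-not c xs))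

∑-indicator : ∀ (c : A → Bool) xs X → ∑ xs (λ x → if c x then X else 0ℚ) ≡ count c xs · X
∑-indicator c []       X = refl
∑-indicator c (x ∷ xs) X with c x
... | true  = cong (X +_) (∑-indicator c xs X)
... | false = ≡.trans (ℚₚ.+-identityˡ _) (∑-indicator c xs X)

∑-if : ∀ (c : A → Bool) xs X Y → ∑ xs (λ x → if c x then X else Y) ≡ count c xs · X + count (not ∘ c) xs · Y
∑-if c []       X Y = refl
∑-if c (x ∷ xs) X Y with c x
... | true  = ≡.trans (cong (X +_) (∑-if c xs X Y)) (≡.sym (ℚₚ.+-assoc X _ _))
... | false = ≡.trans (cong (Y +_) (∑-if c xs X Y)) (x∙yz≈y∙xz Y (count c xs · X) (count (not ∘ c) xs · Y))

separated : (A → Bool) → ℚ → A → A → ℚ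
separated c X x y = if c x xor c y then X else 0ℚ

∑-separated : ∀ (c : A → Bool) xs X → let ℓ = count c xs; r = count (not ∘ c) xs in
              ∑ xs (λ x → ∑ xs (separated c X x)) ≡ (ℓ * r ℕ.+ r * ℓ) · X
∑-separated c xs X = begin
  ∑ xs (λ x → ∑ xs (separated c X x))              ≡⟨ ∑-cong xs (λ {x} _ → row (c x)) ⟩
  ∑ xs (λ x → if c x then r · X else ℓ · X)        ≡⟨ ∑-if c xs (r · X) (ℓ · X) ⟩
  ℓ · (r · X) + r · (ℓ · X)                        ≡⟨ cong₂ _+_ (×-assocˡ X ℓ r) (×-assocˡ X r ℓ) ⟩
  (ℓ * r) · X + (r * ℓ) · X                        ≡⟨ ×-homo-+ X (ℓ * r) (r * ℓ) ⟨
  (ℓ * r ℕ.+ r * ℓ) · X                            ∎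
  where
  open ≡.≡-Reasoning
  ℓ = count c xs
  r = count (not ∘ c) xs
  row : ∀ b → ∑ xs (λ y → if b xor c y then X else 0ℚ) ≡ (if b then r · X else ℓ · X)
  row true  = ∑-indicator (not ∘ c) xs X
  row false = ∑-indicator c xs X

-- With c′ = t + b, c = c′ + d and a = c + t this reads c c′ - a b = t (t + d): moving t units from
-- the smaller to the larger part of a split costs t (t + d), which vanishes only for t = 0.
*-gap : ∀ t b d → (t ℕ.+ b ℕ.+ d ℕ.+ t) * b ℕ.+ t * (t ℕ.+ d) ≡ (t ℕ.+ b ℕ.+ d) * (t ℕ.+ b)
*-gap = solve 3 (λ t b d → (t :+ b :+ d :+ t) :* b :+ t :* (t :+ d) := (t :+ b :+ d) :* (t :+ b)) refl
  where
  open import Data.Nat.Solver using (module +-*-Solver)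
  open +-*-Solver

balanced-* : ∀ {a b c c′} → a ℕ.+ b ≡ c ℕ.+ c′ → c′ ≤ c → c ≤ a →
             a * b ≤ c * c′ × (c * c′ ≤ a * b → a ≡ c)
balanced-* {a} {b} {c} {c′} a+b c′≤c c≤a
  with t , refl ← ℕₚ.m≤n⇒∃[o]m+o≡n c≤a
  with refl ← ℕₚ.+-cancelˡ-≡ c (t ℕ.+ b) c′ (≡.trans (≡.sym (ℕₚ.+-assoc c t b)) a+b)
  with d , refl ← ℕₚ.m≤n⇒∃[o]m+o≡n c′≤c =
    subst ((t ℕ.+ b ℕ.+ d ℕ.+ t) * b ≤_) (*-gap t b d) (ℕₚ.m≤m+n _ _) ,
    λ big → ≡.trans (cong (c ℕ.+_) (t≡0 t (excess≡0 (subst (_≤ (t ℕ.+ b ℕ.+ d ℕ.+ t) * b) (≡.sym (*-gap t b d)) big)))) (ℕₚ.+-identityʳ _)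
  where
  excess≡0 : ∀ {m n} → m ℕ.+ n ≤ m → n ≡ 0
  excess≡0 {m} {n} m+n≤m = ℕₚ.n≤0⇒n≡0 (ℕₚ.+-cancelˡ-≤ m n 0 (subst (m ℕ.+ n ≤_) (≡.sym (ℕₚ.+-identityʳ m)) m+n≤m))
  t≡0 : ∀ t {s} → t * (t ℕ.+ s) ≡ 0 → t ≡ 0
  t≡0 zero _ = refl

-- If a < c, then a ≤ c′ because c and c′ differ by at most one, hence b ≥ c and the two parts
-- exchange roles. This is why equality determines the parts only up to a swap.
balanced : ∀ {a b c c′} → a ℕ.+ b ≡ c ℕ.+ c′ → c′ ≤ c → c ≤ suc c′ →
           a * b ≤ c * c′ × (c * c′ ≤ a * b → a ≡ c ⊎ b ≡ c)
balanced {a} {b} {c} {c′} a+b c′≤c c≤1+c′ with c ℕ.≤? a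
... | yes c≤a = let le , eq = balanced-* a+b c′≤c c≤a in le , inj₁ ∘ eq
... | no  c≰a =
  let a≤c′    = ℕ.s≤s⁻¹ (ℕₚ.≤-trans (ℕₚ.≰⇒> c≰a) c≤1+c′)
      b+a     = ≡.trans (ℕₚ.+-comm b a) a+b
      c≤b     = ℕₚ.≮⇒≥ λ b<c → ℕₚ.<-irrefl b+a
                  (ℕₚ.+-mono-<-≤ b<c a≤c′)
      le , eq = balanced-* b+a c′≤c c≤b
  in subst (_≤ c * c′) (ℕₚ.*-comm b a) le , λ big → inj₂ (eq (subst (c * c′ ≤_) (ℕₚ.*-comm a b) big))

-- Walks and distances

any⁻ : ∀ (p : A → Bool) xs → any p xs ≡ true → ∃ λ x → p x ≡ true
any⁻ p (x ∷ xs) eq with p x in px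
... | true  = x , px
... | false = any⁻ p xs eq

any⁺ : ∀ (p : A → Bool) {xs x} → x ∈ xs → p x ≡ true → any p xs ≡ true
any⁺ p (here refl) px rewrite px = refl
any⁺ p {y ∷ _} (there x∈) px with p y
... | true  = refl
... | false = any⁺ p x∈ px

∧-true : ∀ {a b} → a ∧ b ≡ true → a ≡ true × b ≡ true
∧-true {true} {true} _ = refl , refl

-- The index is a budget rather than an exact length: `stay` is allowed with steps to spare, in
-- agreement with `reach`.
data Walk {n} (G : Graph n) : ℕ → Fin n → Fin n → Set where
  stay : ∀ {k u} → Walk G k u u
  step : ∀ {k u w v} → adj G u w ≡ true → Walk G k w v → Walk G (suc k) u v

module _ {n} (G : Graph n) where

  adj-sym : ∀ {u v} → adj G u v ≡ true → adj G v u ≡ true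
  adj-sym {u} {v} = ≡.trans (sym G v u)

  adj⇒≢ : ∀ {u v} → adj G u v ≡ true → u ≢ v
  adj⇒≢ {u} uv refl with () ← ≡.trans (≡.sym uv) (irrefl G u)

  weaken : ∀ {k u v} → Walk G k u v → Walk G (suc k) u v
  weaken stay       = stay
  weaken (step a w) = step a (weaken w)

  snoc : ∀ {k u v w} → Walk G k u v → adj G v w ≡ true → Walk G (suc k) u w
  snoc stay       b = step b stay
  snoc (step a w) b = step a (snoc w b)

  reverse-walk : ∀ {k u v} → Walk G k u v → Walk G k v u
  reverse-walk stay       = stay
  reverse-walk (step a w) = snoc (reverse-walk w) (adj-sym a)

  reach⇒walk : ∀ k {u v} → reach G k u v ≡ true → Walk G k u v
  reach⇒walk zero {u} {v} r with u Fin.≟ v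
  ... | yes refl = stay
  reach⇒walk (suc k) {u} {v} r with reach G k u v in eq
  ... | true  = weaken (reach⇒walk k eq)
  ... | false with w , aw ← any⁻ _ (allFin n) r with a , rw ← ∧-true aw = step a (reach⇒walk k rw)

  walk⇒reach : ∀ {k u v} → Walk G k u v → reach G k u v ≡ true
  walk⇒reach {zero}  {u} stay with u Fin.≟ u
  ... | yes _   = refl
  ... | no  u≢u = contradiction refl u≢u
  walk⇒reach {suc k} {u} stay rewrite walk⇒reach {k} {u} stay = refl
  walk⇒reach {suc k} {u} {v} (step {w = w} a p) with reach G k u v
  ... | true  = refl
  ... | false = any⁺ _ (∈-allFin w) (cong₂ _∧_ a (walk⇒reach p))

search-≤ : ∀ p s fuel {j} → p j ≡ true → s ≤ j → searchFrom p s fuel ≤ j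
search-≤ p s zero       pj s≤j = s≤j
search-≤ p s (suc fuel) pj s≤j with p s in ps
... | true  = s≤j
... | false = search-≤ p (suc s) fuel pj (ℕₚ.≤∧≢⇒< s≤j λ { refl → false≢true (≡.trans (≡.sym ps) pj) })
  where
  false≢true : false ≢ true
  false≢true ()

search-spec : ∀ p s fuel → p (searchFrom p s fuel) ≡ true ⊎ searchFrom p s fuel ≡ s ℕ.+ fuel
search-spec p s zero = inj₂ (≡.sym (ℕₚ.+-identityʳ s))
search-spec p s (suc fuel) with p s in ps
... | true  = inj₁ ps
... | false rewrite ℕₚ.+-suc s fuel = search-spec p (suc s) fuel

search-≤-fuel : ∀ p s fuel → searchFrom p s fuel ≤ s ℕ.+ fuel
search-≤-fuel p s zero = ℕₚ.m≤m+n s 0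
search-≤-fuel p s (suc fuel) with p s
... | true  = ℕₚ.m≤m+n s (suc fuel)
... | false rewrite ℕₚ.+-suc s fuel = search-≤-fuel p (suc s) fuel

search-cong : ∀ {p q} → (∀ j → p j ≡ q j) → ∀ s fuel → searchFrom p s fuel ≡ searchFrom q s fuel
search-cong p≗q s zero = refl
search-cong {p} {q} p≗q s (suc fuel) rewrite p≗q s | search-cong {p} {q} p≗q (suc s) fuel = refl

dist-cong : ∀ {n} {G H : Graph n} {u v u′ v′} →
            (∀ {k} → Walk G k u v → Walk H k u′ v′) → (∀ {k} → Walk H k u′ v′ → Walk G k u v) →
            dist G u v ≡ dist H u′ v′
dist-cong {n} {G} {H} to from = search-cong (λ k → ⇔→≡ (mk⇔
  (walk⇒reach H ∘ to ∘ reach⇒walk G k) (walk⇒reach G ∘ from ∘ reach⇒walk H k))) 0 n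

module Distance {n} (G : Graph n) where

  d : Fin n → Fin n → ℕ
  d = dist G

  d-≤ : ∀ {k u v} → Walk G k u v → d u v ≤ k
  d-≤ w = search-≤ _ 0 n (walk⇒reach G w) ℕ.z≤n

  -- `dist` truncates at n, so a walk realising it is only known to exist below n.
  d-walk : ∀ u v → Walk G (d u v) u v ⊎ d u v ≡ n
  d-walk u v with search-spec (λ k → reach G k u v) 0 n
  ... | inj₁ r = inj₁ (reach⇒walk G (d u v) r)
  ... | inj₂ e = inj₂ e

  d-sym : ∀ u v → d u v ≡ d v u
  d-sym u v = dist-cong (reverse-walk G) (reverse-walk G)

  d-refl : ∀ u → d u u ≡ 0
  d-refl u = ℕₚ.n≤0⇒n≡0 (d-≤ stay)

  d-adj : ∀ {u v} → adj G u v ≡ true → d u v ≤ 1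
  d-adj a = d-≤ (step a stay)

  d-step : ∀ {u w} v → adj G u w ≡ true → d u v ≤ suc (d w v)
  d-step {u} {w} v a with d-walk w v
  ... | inj₁ p = d-≤ (step a p)
  ... | inj₂ e = subst (λ k → d u v ≤ suc k) (≡.sym e)
                   (ℕₚ.m≤n⇒m≤1+n (search-≤-fuel (λ k → reach G k u v) 0 n))

  d-stepʳ : ∀ {u w} v → adj G u w ≡ true → d v u ≤ suc (d v w)
  d-stepʳ {u} {w} v a rewrite d-sym v u | d-sym v w = d-step v a

  -- For b ≤ n the truncated value n satisfies the bound as well, so lower bounds on distances
  -- follow from walks alone, without knowing that the two vertices are connected.
  d-≥ : ∀ {u v b} → b ≤ n → (∀ {k} → Walk G k u v → b ≤ k) → b ≤ d u v
  d-≥ {u} {v} b≤n w≥b with d-walk u v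
  ... | inj₁ w = w≥b w
  ... | inj₂ e = subst (_ ≤_) (≡.sym e) b≤n

  d-pos : ∀ {u v} → u ≢ v → 1 ≤ d u v
  d-pos {u} {v} u≢v = d-≥ (Fin-inhabited u) λ { stay → contradiction refl u≢v ; (step _ _) → ℕ.s≤s ℕ.z≤n }
    where
    Fin-inhabited : ∀ {n} → Fin n → 1 ≤ n
    Fin-inhabited {suc n} _ = ℕ.s≤s ℕ.z≤n

-- The double sum of a graph and its invariance under isomorphism

-- Two leaves of 𝒜 on the same side are at distance 2, so giving the diagonal the value f 2 makes
-- the contribution of a pair to the sum for 𝒜 a function of where its two vertices sit along 𝒜.
value : ∀ {n} → (ℕ → ℚ) → Graph n → Fin n → Fin n → ℚ
value f G u v = if does (u Fin.≟ v) then f 2 else f (dist G u v)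

value-≡ : ∀ {n} f (G : Graph n) u → value f G u u ≡ f 2
value-≡ f G u rewrite dec-true (u Fin.≟ u) refl = refl

value-≢ : ∀ {n} f (G : Graph n) {u v} → u ≢ v → value f G u v ≡ f (dist G u v)
value-≢ f G {u} {v} u≢v rewrite dec-false (u Fin.≟ v) u≢v = refl

value-sym : ∀ {n} f (G : Graph n) u v → value f G u v ≡ value f G v u
value-sym f G u v with u Fin.≟ v
... | yes refl = ≡.sym (value-≡ f G u)
... | no u≢v   = ≡.trans (cong f (Distance.d-sym G u v)) (≡.sym (value-≢ f G (u≢v ∘ ≡.sym)))

∑∑ : List A → List B → (A → B → ℚ) → ℚ
∑∑ xs ys g = ∑ xs (λ x → ∑ ys (g x))

∑∑-cong : ∀ (xs : List A) (ys : List B) {g h} → (∀ {x y} → x ∈ xs → y ∈ ys → g x y ≡ h x y) →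
          ∑∑ xs ys g ≡ ∑∑ xs ys h
∑∑-cong xs ys g≡h = ∑-cong xs (λ x∈ → ∑-cong ys (g≡h x∈))

∑∑-mono : ∀ (xs : List A) (ys : List B) {g h} → (∀ {x y} → x ∈ xs → y ∈ ys → g x y Q.≤ h x y) →
          ∑∑ xs ys g Q.≤ ∑∑ xs ys h
∑∑-mono xs ys g≤h = ∑-mono xs (λ x∈ → ∑-mono ys (g≤h x∈))

∑∑-+ : ∀ (xs : List A) (ys : List B) g h → ∑∑ xs ys (λ x y → g x y + h x y) ≡ ∑∑ xs ys g + ∑∑ xs ys h
∑∑-+ xs ys g h = ≡.trans (∑-cong xs (λ {x} _ → ∑-+ ys (g x) (h x))) (∑-+ xs _ _)

∑∑-↭ : ∀ {xs xs′ : List A} {ys ys′ : List B} g → xs ↭ xs′ → ys ↭ ys′ → ∑∑ xs ys g ≡ ∑∑ xs′ ys′ g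
∑∑-↭ {xs = xs} g σ τ = ≡.trans (∑-cong xs (λ {x} _ → ∑-↭ (g x) τ)) (∑-↭ _ σ)

∑∑-map : ∀ {A B : Set} (h : A → B) xs ys g → ∑∑ (map h xs) (map h ys) g ≡ ∑∑ xs ys (λ x y → g (h x) (h y))
∑∑-map h xs ys g = ≡.trans (∑-map h xs _) (∑-cong xs (λ {x} _ → ∑-map h ys (g (h x))))

∑∑-++ : ∀ (xs ys : List A) {g : A → A → ℚ} → (∀ x y → g x y ≡ g y x) →
        ∑∑ (xs ++ ys) (xs ++ ys) g ≡ ∑∑ xs xs g + (∑∑ ys xs g + ∑∑ ys xs g) + ∑∑ ys ys g
∑∑-++ xs ys {g} g-sym = begin
  ∑∑ (xs ++ ys) (xs ++ ys) g                                    ≡⟨ ∑-++ xs _ ⟩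
  ∑∑ xs (xs ++ ys) g + ∑∑ ys (xs ++ ys) g                       ≡⟨ cong₂ _+_ (row xs) (row ys) ⟩
  (∑∑ xs xs g + ∑∑ xs ys g) + (∑∑ ys xs g + ∑∑ ys ys g)         ≡⟨ cong (λ s → (∑∑ xs xs g + s) + (∑∑ ys xs g + ∑∑ ys ys g)) flip ⟩
  (∑∑ xs xs g + ∑∑ ys xs g) + (∑∑ ys xs g + ∑∑ ys ys g)         ≡⟨ ℚₚ.+-assoc (∑∑ xs xs g + ∑∑ ys xs g) (∑∑ ys xs g) (∑∑ ys ys g) ⟨
  ∑∑ xs xs g + ∑∑ ys xs g + ∑∑ ys xs g + ∑∑ ys ys g             ≡⟨ cong (_+ ∑∑ ys ys g) (ℚₚ.+-assoc (∑∑ xs xs g) (∑∑ ys xs g) (∑∑ ys xs g)) ⟩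
  ∑∑ xs xs g + (∑∑ ys xs g + ∑∑ ys xs g) + ∑∑ ys ys g           ∎
  where
  open ≡.≡-Reasoning
  row : ∀ zs → ∑∑ zs (xs ++ ys) g ≡ ∑∑ zs xs g + ∑∑ zs ys g
  row zs = ≡.trans (∑-cong zs (λ {z} _ → ∑-++ xs (g z))) (∑-+ zs _ _)
  flip : ∑∑ xs ys g ≡ ∑∑ ys xs g
  flip = ≡.trans (∑-swap xs ys g) (∑∑-cong ys xs (λ {y} {x} _ _ → g-sym x y))

total : ∀ {n} → (ℕ → ℚ) → Graph n → ℚ
total {n} f G = ∑∑ (allFin n) (allFin n) (value f G)

sumℚ-concatMap : ∀ (h : A → List ℚ) xs → sumℚ (concatMap h xs) ≡ ∑ xs (sumℚ ∘ h)
sumℚ-concatMap h []       = refl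
sumℚ-concatMap h (x ∷ xs) = ≡.trans (sumℚ-++ (h x)) (cong (sumℚ (h x) +_) (sumℚ-concatMap h xs))
  where
  sumℚ-++ : ∀ qs {rs} → sumℚ (qs ++ rs) ≡ sumℚ qs + sumℚ rs
  sumℚ-++ []       = ≡.sym (ℚₚ.+-identityˡ _)
  sumℚ-++ (q ∷ qs) = ≡.trans (cong (q +_) (sumℚ-++ qs)) (≡.sym (ℚₚ.+-assoc q (sumℚ qs) _))

diagonal : ℕ → (ℕ → ℚ) → ℚ
diagonal n f = ∑∑ (allFin n) (allFin n) (λ u v → if does (u Fin.≟ v) then f 2 else 0ℚ)

-- Ordered pairs make the sum independent of the numbering and let it split along any partition of
-- the vertices. The diagonal correction depends only on n, so it cancels whenever two graphs are
-- compared.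
total≡Wf : ∀ {n} f (G : Graph n) → total f G ≡ Wf f G + Wf f G + diagonal n f
total≡Wf {n} f G = begin
  ∑∑ V V (value f G)                                          ≡⟨ ∑∑-cong V V (λ {u} {v} _ _ → split u v) ⟩
  ∑∑ V V (λ u v → upper u v + upper v u + diag u v)           ≡⟨ ∑∑-+ V V (λ u v → upper u v + upper v u) diag ⟩
  ∑∑ V V (λ u v → upper u v + upper v u) + diagonal n f       ≡⟨ cong (_+ diagonal n f) (∑∑-+ V V upper (λ u v → upper v u)) ⟩
  ∑∑ V V upper + ∑∑ V V (λ u v → upper v u) + diagonal n f    ≡⟨ cong₂ (λ a b → a + b + diagonal n f) upper≡ (≡.trans (∑-swap V V (λ u v → upper v u)) upper≡) ⟩
  Wf f G + Wf f G + diagonal n f                              ∎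
  where
  open ≡.≡-Reasoning
  V = allFin n
  upper diag : Fin n → Fin n → ℚ
  upper u v = if toℕ u ℕ.<ᵇ toℕ v then f (dist G u v) else 0ℚ
  diag u v = if does (u Fin.≟ v) then f 2 else 0ℚ
  upper≡ : ∑∑ V V upper ≡ Wf f G
  upper≡ = ≡.sym (≡.trans (sumℚ-concatMap _ V) (∑-cong V (λ {u} _ →
    ≡.trans (sumℚ-concatMap _ V) (∑-cong V (λ {v} _ → singleton (toℕ u ℕ.<ᵇ toℕ v) (f (dist G u v)))))))
    where
    singleton : ∀ b q → sumℚ (if b then q ∷ [] else []) ≡ (if b then q else 0ℚ)
    singleton true  q = ℚₚ.+-identityʳ q
    singleton false q = refl
  split : ∀ u v → value f G u v ≡ upper u v + upper v u + diag u v
  split u v with ℕₚ.<-cmp (toℕ u) (toℕ v)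
  ... | tri< u<v u≢v v≮u
    rewrite dec-true (toℕ u ℕ.<? toℕ v) u<v | dec-false (toℕ v ℕ.<? toℕ u) v≮u
          | dec-false (u Fin.≟ v) (u≢v ∘ cong toℕ)
    = ≡.sym (≡.trans (ℚₚ.+-identityʳ _) (ℚₚ.+-identityʳ _))
  ... | tri> u≮v u≢v v<u
    rewrite dec-false (toℕ u ℕ.<? toℕ v) u≮v | dec-true (toℕ v ℕ.<? toℕ u) v<u
          | dec-false (u Fin.≟ v) (u≢v ∘ cong toℕ)
    = ≡.sym (≡.trans (ℚₚ.+-identityʳ _) (≡.trans (ℚₚ.+-identityˡ _) (cong f (Distance.d-sym G v u))))
  ... | tri≈ u≮v u≡v v≮u
    rewrite dec-false (toℕ u ℕ.<? toℕ v) u≮v | dec-false (toℕ v ℕ.<? toℕ u) v≮u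
          | dec-true (u Fin.≟ v) (toℕ-injective u≡v)
    = ≡.sym (ℚₚ.+-identityˡ _)

total-cancel-≤ : ∀ {n} f (G H : Graph n) → total f G Q.≤ total f H → Wf f G Q.≤ Wf f H
total-cancel-≤ {n} f G H le =
  double-cancel-≤ (+-cancelʳ-≤ (diagonal n f) (≡.subst₂ Q._≤_ (total≡Wf f G) (total≡Wf f H) le))

total-cong : ∀ {n} f (G H : Graph n) → Wf f G ≡ Wf f H → total f G ≡ total f H
total-cong {n} f G H eq = ≡.trans (total≡Wf f G)
  (≡.trans (cong (λ w → w + w + diagonal n f) eq) (≡.sym (total≡Wf f H)))

map-walk : ∀ {n} {G H : Graph n} (h : Fin n → Fin n) →
           (∀ u v → adj G u v ≡ true → adj H (h u) (h v) ≡ true) →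
           ∀ {k u v} → Walk G k u v → Walk H k (h u) (h v)
map-walk h hom stay       = stay
map-walk h hom (step a w) = step (hom _ _ a) (map-walk h hom w)

same-elements⇒↭ : ∀ {xs ys : List A} → Unique xs → Unique ys →
                  (∀ {x} → x ∈ xs → x ∈ ys) → (∀ {x} → x ∈ ys → x ∈ xs) → xs ↭ ys
same-elements⇒↭ xs! ys! to from = ∼bag⇒↭ (unique∧set⇒bag xs! ys! (mk⇔ to from))

module Isomorphism {n} (G H : Graph n) (φ : Fin n ↔ Fin n)
                   (φ-adj : ∀ u v → adj G u v ≡ adj H (Inverse.to φ u) (Inverse.to φ v)) where
  open Inverse φ using (to; from; strictlyInverseʳ; strictlyInverseˡ)

  to-injective : ∀ {u v} → to u ≡ to v → u ≡ v
  to-injective {u} {v} eq = ≡.trans (≡.sym (strictlyInverseʳ u)) (≡.trans (cong from eq) (strictlyInverseʳ v))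

  dist-iso : ∀ u v → dist G u v ≡ dist H (to u) (to v)
  dist-iso u v = dist-cong
    (map-walk to (λ u v → ≡.trans (≡.sym (φ-adj u v))))
    (λ w → ≡.subst₂ (Walk G _) (strictlyInverseʳ u) (strictlyInverseʳ v) (map-walk from back w))
    where
    back : ∀ x y → adj H x y ≡ true → adj G (from x) (from y) ≡ true
    back x y a = ≡.trans (φ-adj (from x) (from y))
      (≡.trans (cong₂ (adj H) (strictlyInverseˡ x) (strictlyInverseˡ y)) a)

  -- `Wf` selects pairs by their index order, which φ need not respect; the detour through `total`
  -- turns the relabelling into a permutation of the summation lists.
  Wf-iso : ∀ f → Wf f G ≡ Wf f H
  Wf-iso f = ℚₚ.≤-antisym (total-cancel-≤ f G H (ℚₚ.≤-reflexive total≡))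
                          (total-cancel-≤ f H G (ℚₚ.≤-reflexive (≡.sym total≡)))
    where
    V = allFin n
    value-iso : ∀ u v → value f G u v ≡ value f H (to u) (to v)
    value-iso u v with u Fin.≟ v
    ... | yes refl = ≡.sym (value-≡ f H (to u))
    ... | no u≢v   = ≡.trans (cong f (dist-iso u v)) (≡.sym (value-≢ f H (u≢v ∘ to-injective)))
    relabel : map to V ↭ V
    relabel = same-elements⇒↭ (Unique.map⁺ to-injective (Unique.allFin⁺ n)) (Unique.allFin⁺ n)
      (λ _ → ∈-allFin _) (λ {x} _ → subst (_∈ map to V) (strictlyInverseˡ x) (∈-map⁺ to (∈-allFin (from x))))
    total≡ : total f G ≡ total f H
    total≡ = ≡.trans (∑∑-cong V V (λ {u} {v} _ _ → value-iso u v))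
      (≡.trans (≡.sym (∑∑-map to V V (value f H))) (∑∑-↭ (value f H) relabel relabel))

-- Vertex lists in which each vertex has an earlier neighbour

mono-≤ : ∀ {g : ℕ → ℚ} → (∀ i → g i Q.≤ g (suc i)) → ∀ {i j} → i ≤ j → g i Q.≤ g j
mono-≤ {g} g-mono {i} i≤j with ℕₚ.m≤n⇒m<n∨m≡n i≤j
mono-≤ {g} g-mono {i} {suc j} i≤j | inj₁ (ℕ.s≤s i≤j′) = ℚₚ.≤-trans (mono-≤ g-mono i≤j′) (g-mono j)
... | inj₂ refl = ℚₚ.≤-refl

mono-< : ∀ {g : ℕ → ℚ} → (∀ i → g i < g (suc i)) → ∀ {i j} → i ℕ.< j → g i < g j
mono-< g-mono {i} i<j = ℚₚ.<-≤-trans (g-mono i) (mono-≤ (λ k → ℚₚ.<⇒≤ (g-mono k)) i<j)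

strict-injective : ∀ {g : ℕ → ℚ} → (∀ i → g i < g (suc i)) → ∀ {i j} → g i ≡ g j → i ≡ j
strict-injective g-mono {i} {j} eq with ℕₚ.<-cmp i j
... | tri< i<j _ _ = contradiction (mono-< g-mono i<j) (ℚₚ.<-irrefl eq)
... | tri≈ _ i≡j _ = i≡j
... | tri> _ _ j<i = contradiction (mono-< g-mono j<i) (ℚₚ.<-irrefl (≡.sym eq))

downFrom-suc : ∀ k → downFrom (suc k) ↭ 0 ∷ map suc (downFrom k)
downFrom-suc zero    = ↭-refl
downFrom-suc (suc k) = ↭-trans (↭-prep (suc k) (downFrom-suc k)) (Perm.swap (suc k) 0 ↭-refl)

∑-downFrom-suc : ∀ k g → ∑ (downFrom (suc k)) g ≡ g 0 + ∑ (downFrom k) (g ∘ suc)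
∑-downFrom-suc k g = ≡.trans (∑-↭ g (downFrom-suc k)) (cong (g 0 +_) (∑-map suc (downFrom k) g))

∑∑-∷ : ∀ (x : A) xs {g} → (∀ x y → g x y ≡ g y x) →
       ∑∑ (x ∷ xs) (x ∷ xs) g ≡ g x x + (∑ xs (g x) + ∑ xs (g x)) + ∑∑ xs xs g
∑∑-∷ x xs {g} g-sym = ≡.trans (∑∑-++ (x ∷ []) xs g-sym)
  (cong₂ (λ a b → a + (b + b) + ∑∑ xs xs g)
    (≡.trans (ℚₚ.+-identityʳ (g x x + 0ℚ)) (ℚₚ.+-identityʳ (g x x)))
    (∑-cong xs (λ {y} _ → ≡.trans (ℚₚ.+-identityʳ _) (g-sym y x))))

∑-path : (ℕ → ℚ) → ℕ → ℚ
∑-path f k = ∑ (downFrom k) (f ∘ suc)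

-- The double sum of `value` over a path on k vertices, peeled from one end: the end vertex sees the
-- distances 1, ..., k - 1, once in each order, and f 2 is its diagonal term.
∑∑-path : (ℕ → ℚ) → ℕ → ℚ
∑∑-path f zero    = 0ℚ
∑∑-path f (suc k) = f 2 + (∑-path f k + ∑-path f k) + ∑∑-path f k

count-map : ∀ (q : B → Bool) (h : A → B) xs → count q (map h xs) ≡ count (q ∘ h) xs
count-map q h []       = refl
count-map q h (x ∷ xs) with q (h x)
... | true  = cong suc (count-map q h xs)
... | false = count-map q h xs

separations : List (A → Bool) → A → A → ℕ
separations cs x y = count (λ c → c x xor c y) cs

map-cong-∈ : ∀ {h h′ : A → B} xs → (∀ {x} → x ∈ xs → h x ≡ h′ x) → map h xs ≡ map h′ xs
map-cong-∈ []       eq = refl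
map-cong-∈ (x ∷ xs) eq = cong₂ _∷_ (eq (here refl)) (map-cong-∈ xs (eq ∘ there))

module Growth {n} (G : Graph n) where

  open Distance G

  -- A connected set together with an order in which it can be built. The order drives the
  -- inductions, and the chosen edges from v to p form a spanning tree.
  data Grown : List (Fin n) → Set where
    root : ∀ v → Grown (v ∷ [])
    grow : ∀ {v p l} → Grown l → v ∉ l → p ∈ l → adj G v p ≡ true → Grown (v ∷ l)

  grown-unique : ∀ {l} → Grown l → Unique l
  grown-unique (root v)           = [] ∷ []
  grown-unique (grow gr v∉l _ _)  = ¬Any⇒All¬ _ v∉l ∷ grown-unique gr

  d<length : ∀ {l} → Grown l → ∀ {x y} → x ∈ l → y ∈ l → d x y ℕ.< length l
  d<length (root v) (here refl) (here refl) rewrite d-refl v = ℕ.s≤s ℕ.z≤n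
  d<length (grow {v} gr _ _ _) (here refl) (here refl) rewrite d-refl v = ℕ.s≤s ℕ.z≤n
  d<length (grow gr _ p∈ a) (here refl) (there y∈) =
    ℕ.s≤s (ℕₚ.≤-trans (d-step _ a) (d<length gr p∈ y∈))
  d<length (grow gr _ p∈ a) (there x∈) (here refl) =
    ℕ.s≤s (ℕₚ.≤-trans (d-stepʳ _ a) (d<length gr x∈ p∈))
  d<length (grow gr _ _ _) (there x∈) (there y∈) = ℕₚ.m≤n⇒m≤1+n (d<length gr x∈ y∈)

  mutual
    -- Seen from an older vertex, the newest one is at distance at most `length l`, which is the
    -- first entry of `downFrom`. Seen from the newest vertex, the others form an outer row.
    -- Admitting every nondecreasing g lets `outer-row-≤` absorb the extra step to p as the shift g
    -- ∘ suc.
    row-≤ : ∀ {l} → Grown l → ∀ {g} → (∀ i → g i Q.≤ g (suc i)) → ∀ {a} → a ∈ l →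
            ∑ l (g ∘ d a) Q.≤ ∑ (downFrom (length l)) g
    row-≤ (root v) {g} g-mono (here refl) = ℚₚ.≤-reflexive (cong (λ t → g t + 0ℚ) (d-refl v))
    row-≤ (grow {v} {l = l} gr _ p∈ a) {g} g-mono (here refl) = begin
      g (d v v) + ∑ l (g ∘ d v)                     ≤⟨ ℚₚ.+-mono-≤ (ℚₚ.≤-reflexive (cong g (d-refl v))) (outer-row-≤ gr g-mono p∈ a) ⟩
      g 0 + ∑ (downFrom (length l)) (g ∘ suc)       ≡⟨ ∑-downFrom-suc (length l) g ⟨
      ∑ (downFrom (suc (length l))) g               ∎
      where open ℚₚ.≤-Reasoning
    row-≤ (grow gr _ p∈ a) g-mono (there x∈) = ℚₚ.+-mono-≤
      (mono-≤ g-mono (ℕₚ.≤-trans (d-stepʳ _ a) (d<length gr x∈ p∈))) (row-≤ gr g-mono x∈)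

    outer-row-≤ : ∀ {l} → Grown l → ∀ {g} → (∀ i → g i Q.≤ g (suc i)) →
                  ∀ {v p} → p ∈ l → adj G v p ≡ true →
                  ∑ l (g ∘ d v) Q.≤ ∑ (downFrom (length l)) (g ∘ suc)
    outer-row-≤ {l} gr g-mono p∈ a = ℚₚ.≤-trans
      (∑-mono l (λ {x} _ → mono-≤ g-mono (d-step x a)))
      (row-≤ gr (g-mono ∘ suc) p∈)

  mutual
    -- Follows the cases of `row-≤`. Strict monotonicity turns equal g-values back into equal
    -- distances; the conclusion is a permutation because the sums see only the multiset of
    -- distances.
    row-rigid : ∀ {l} → Grown l → ∀ {g} → (∀ i → g i < g (suc i)) → ∀ {a} → a ∈ l →
                ∑ (downFrom (length l)) g Q.≤ ∑ l (g ∘ d a) → map (d a) l ↭ downFrom (length l)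
    row-rigid (root v) g-mono (here refl) _ = ↭-reflexive (cong (_∷ []) (d-refl v))
    row-rigid (grow {v} {l = l} gr _ p∈ a) {g} g-mono (here refl) eq = ↭-trans
      (↭-trans (↭-reflexive (cong (_∷ map (d v) l) (d-refl v))) (↭-prep 0 (outer-row-rigid gr g-mono p∈ a tail)))
      (↭-sym (downFrom-suc (length l)))
      where
      tail : ∑ (downFrom (length l)) (g ∘ suc) Q.≤ ∑ l (g ∘ d v)
      tail = ℚₚ.≤-reflexive (≡.sym (+-rigidʳ (ℚₚ.≤-reflexive (cong g (d-refl v)))
        (outer-row-≤ gr (λ i → ℚₚ.<⇒≤ (g-mono i)) p∈ a)
        (subst (Q._≤ g (d v v) + ∑ l (g ∘ d v)) (∑-downFrom-suc (length l) g) eq)))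
    row-rigid (grow {v} {p} {l} gr _ p∈ a) {g} g-mono {x} (there x∈) eq = ↭-trans
      (↭-reflexive (cong (_∷ map (d x) l) (strict-injective g-mono (+-rigidˡ first rest eq))))
      (↭-prep (length l) (row-rigid gr g-mono x∈ (ℚₚ.≤-reflexive (≡.sym (+-rigidʳ first rest eq)))))
      where
      g-mono′ = λ i → ℚₚ.<⇒≤ (g-mono i)
      first : g (d x v) Q.≤ g (length l)
      first = mono-≤ g-mono′ (ℕₚ.≤-trans (d-stepʳ _ a) (d<length gr x∈ p∈))
      rest : ∑ l (g ∘ d x) Q.≤ ∑ (downFrom (length l)) g
      rest = row-≤ gr g-mono′ x∈

    -- The sum over suc (d p x) lies between the two sums of the hypothesis. Tightness on one side
    -- gives d v x = suc (d p x) for every x, and on the other it makes the row of p rigid.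
    outer-row-rigid : ∀ {l} → Grown l → ∀ {g} → (∀ i → g i < g (suc i)) →
                      ∀ {v p} → p ∈ l → adj G v p ≡ true →
                      ∑ (downFrom (length l)) (g ∘ suc) Q.≤ ∑ l (g ∘ d v) →
                      map (d v) l ↭ map suc (downFrom (length l))
    outer-row-rigid {l} gr {g} g-mono {v} {p} p∈ a eq = ↭-trans
      (↭-reflexive (≡.trans (map-cong-∈ l λ x∈ → strict-injective g-mono (∑-rigid l v≤p (ℚₚ.≤-trans p≤down eq) x∈)) (map-∘ l)))
      (map⁺ suc (row-rigid gr (g-mono ∘ suc) p∈ (ℚₚ.≤-trans eq (∑-mono l v≤p))))
      where
      g-mono′ = λ i → ℚₚ.<⇒≤ (g-mono i)
      v≤p : ∀ {x} → x ∈ l → g (d v x) Q.≤ g (suc (d p x))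
      v≤p {x} _ = mono-≤ g-mono′ (d-step x a)
      p≤down : ∑ l (λ x → g (suc (d p x))) Q.≤ ∑ (downFrom (length l)) (g ∘ suc)
      p≤down = row-≤ gr (g-mono′ ∘ suc) p∈

  core-≤ : ∀ {l} → Grown l → ∀ {f} → (∀ i → f i Q.≤ f (suc i)) →
           ∑∑ l l (value f G) Q.≤ ∑∑-path f (length l)
  core-≤ (root v) {f} f-mono = ℚₚ.≤-reflexive (≡.trans (∑∑-∷ v [] (value-sym f G))
    (cong (λ q → q + 0ℚ + 0ℚ) (value-≡ f G v)))
  core-≤ (grow {v} {l = l} gr v∉l p∈ a) {f} f-mono = begin
    ∑∑ (v ∷ l) (v ∷ l) (value f G)
      ≡⟨ ∑∑-∷ v l (value-sym f G) ⟩
    value f G v v + (∑ l (value f G v) + ∑ l (value f G v)) + ∑∑ l l (value f G)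
      ≤⟨ ℚₚ.+-mono-≤ (ℚₚ.+-mono-≤ (ℚₚ.≤-reflexive (value-≡ f G v)) (ℚₚ.+-mono-≤ row row)) (core-≤ gr f-mono) ⟩
    ∑∑-path f (suc (length l))
      ∎
    where
    open ℚₚ.≤-Reasoning
    row : ∑ l (value f G v) Q.≤ ∑-path f (length l)
    row = ℚₚ.≤-trans
      (ℚₚ.≤-reflexive (∑-cong l (λ x∈ → value-≢ f G (λ { refl → v∉l x∈ }))))
      (outer-row-≤ gr f-mono p∈ a)

  -- The edges of the spanning tree recorded by `Grown` induce bipartitions, and the tree
  -- distance of two vertices is the number of bipartitions separating them.
  cuts : ∀ {l} → Grown l → ∃ λ cs → suc (length cs) ≡ length l ×
         (∀ {x y} → x ∈ l → y ∈ l → d x y ≤ separations cs x y)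
  cuts (root v) = [] , refl , λ { (here refl) (here refl) → ℕₚ.≤-reflexive (d-refl v) }
  cuts (grow {v} {p} {l} gr v∉l p∈ a) =
    let cs , len , sep = cuts gr in
    is-v ∷ map (_∘ retract) cs , cong suc (≡.trans (cong suc (length-map _ cs)) len) , bound cs sep
    where
    is-v : Fin n → Bool
    is-v x = does (x Fin.≟ v)
    -- The older bipartitions place v on the side of its neighbour p, while the new one isolates v;
    -- a pair involving v is thus separated once more than the corresponding pair with p.
    retract : Fin n → Fin n
    retract x = if is-v x then p else x
    v-is-v : is-v v ≡ true
    v-is-v = dec-true (v Fin.≟ v) refl
    ∈-is-not-v : ∀ {x} → x ∈ l → is-v x ≡ false
    ∈-is-not-v {x} x∈ = dec-false (x Fin.≟ v) λ { refl → v∉l x∈ }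
    module _ (cs : List (Fin n → Bool)) (sep : ∀ {x y} → x ∈ l → y ∈ l → d x y ≤ separations cs x y) where
      lift : ∀ {x y} x′ y′ → retract x ≡ x′ → retract y ≡ y′ → x′ ∈ l → y′ ∈ l →
             d x′ y′ ≤ separations (map (_∘ retract) cs) x y
      lift {x} {y} _ _ refl refl x′∈ y′∈ =
        subst (d (retract x) (retract y) ≤_) (≡.sym (count-map _ (_∘ retract) cs)) (sep x′∈ y′∈)
      retract-v : retract v ≡ p
      retract-v rewrite v-is-v = refl
      retract-∈ : ∀ {x} → x ∈ l → retract x ≡ x
      retract-∈ x∈ rewrite ∈-is-not-v x∈ = refl
      bound : ∀ {x y} → x ∈ v ∷ l → y ∈ v ∷ l → d x y ≤ separations (is-v ∷ map (_∘ retract) cs) x y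
      bound (here refl) (here refl) rewrite d-refl v = ℕ.z≤n
      bound (here refl) (there {y} y∈) rewrite v-is-v | ∈-is-not-v y∈ =
        ℕₚ.≤-trans (d-step _ a) (ℕ.s≤s (lift p _ retract-v (retract-∈ y∈) p∈ y∈))
      bound (there x∈) (here refl) rewrite v-is-v | ∈-is-not-v x∈ =
        ℕₚ.≤-trans (d-stepʳ _ a) (ℕ.s≤s (lift _ p (retract-∈ x∈) retract-v x∈ p∈))
      bound (there x∈) (there y∈) rewrite ∈-is-not-v x∈ | ∈-is-not-v y∈ =
        lift _ _ (retract-∈ x∈) (retract-∈ y∈) x∈ y∈

-- Averaging over the bipartitions

∑∑-const : ∀ (xs : List A) q → ∑∑ xs xs (λ _ _ → q) ≡ length xs · (length xs · q)
∑∑-const xs q = ≡.trans (∑-cong xs (λ _ → ∑-const xs q)) (∑-const xs _)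

∑∑-separated : ∀ q (xs : List A) (c : A → Bool) X → let ℓ = count c xs; r = count (not ∘ c) xs in
               ∑∑ xs xs (λ x y → q + separated c X x y) ≡
               length xs · (length xs · q) + (ℓ * r ℕ.+ r * ℓ) · X
∑∑-separated q xs c X = ≡.trans (∑∑-+ xs xs (λ _ _ → q) (separated c X))
  (cong₂ _+_ (∑∑-const xs q) (∑-separated c xs X))

module Outer (f : ℕ → ℚ) (f-mono : ∀ k → f k Q.≤ f (suc k))
             (f-convex : ∀ k → f (suc k) + f (suc k) Q.≤ f k + f (suc (suc k))) where

  -- The shift by 2 accounts for the steps from two outer vertices to their neighbours in K.
  -- Subtracting f 2 gives h 0 = 0, the starting point of the chord.
  h δ : ℕ → ℚ
  h i = f (2 ℕ.+ i) Q.- f 2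
  δ i = f (3 ℕ.+ i) Q.- f (2 ℕ.+ i)

  f≡f2+h : ∀ i → f (2 ℕ.+ i) ≡ f 2 + h i
  f≡f2+h i = difference (f 2) (f (2 ℕ.+ i))

  h≥0 : ∀ i → 0ℚ Q.≤ h i
  h≥0 i = subst (Q._≤ h i) (ℚₚ.+-inverseʳ (f 2)) (ℚₚ.+-monoˡ-≤ (Q.- f 2) (mono-≤ f-mono (ℕₚ.m≤m+n 2 i)))

  h-chord : ∀ t s → (t ℕ.+ s) · h t Q.≤ t · h (t ℕ.+ s)
  h-chord = chord h δ (ℚₚ.+-inverseʳ (f 2))
    (λ i → solve 3 (λ a b c → c :+ (:- a) := (b :+ (:- a)) :+ (c :+ (:- b))) refl (f 2) (f (2 ℕ.+ i)) (f (3 ℕ.+ i)))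
    λ i → let a = f (2 ℕ.+ i); b = f (3 ℕ.+ i); c = f (4 ℕ.+ i) in
      +-cancelʳ-≤ (a + b) (≡.subst₂ Q._≤_
        (solve 2 (λ a b → b :+ b := (b :+ (:- a)) :+ (a :+ b)) refl a b)
        (solve 3 (λ a b c → a :+ c := (c :+ (:- b)) :+ (a :+ b)) refl a b c)
        (f-convex (2 ℕ.+ i)))
    where
    open import Data.Rational.Solver using (module +-*-Solver)
    open +-*-Solver

  -- Multiplied by the number of bipartitions, the chord bound charges a pair X once for each
  -- bipartition that separates it. After exchanging the summations each bipartition is charged for
  -- its own separated pairs, at most c c′ + c′ c ordered ones.
  outer-≤ : ∀ (xs : List A) (cs : List (A → Bool)) (g : A → A → ℚ) →
            (∀ {x y} → x ∈ xs → y ∈ xs → g x y Q.≤ f (2 ℕ.+ separations cs x y)) →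
            ∀ {c c′} → c ℕ.+ c′ ≡ length xs → c′ ≤ c → c ≤ suc c′ →
            ∑∑ xs xs g Q.≤ length xs · (length xs · f 2) + (c * c′ ℕ.+ c′ * c) · h (length cs)
  outer-≤ {A} xs cs g g≤ {c} {c′} c+c′ c′≤c c≤1+c′ = begin
    ∑∑ xs xs g                                              ≤⟨ ∑∑-mono xs xs (λ x∈ y∈ → ℚₚ.≤-trans (g≤ x∈ y∈) (ℚₚ.≤-reflexive (f≡f2+h _))) ⟩
    ∑∑ xs xs (λ x y → f 2 + h (sep x y))                    ≡⟨ ∑∑-+ xs xs (λ _ _ → f 2) (λ x y → h (sep x y)) ⟩
    ∑∑ xs xs (λ _ _ → f 2) + ∑∑ xs xs (λ x y → h (sep x y)) ≤⟨ ℚₚ.+-mono-≤ (ℚₚ.≤-reflexive (∑∑-const xs (f 2))) (cancel cs refl) ⟩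
    length xs · (length xs · f 2) + N · X                   ∎
    where
    open ℚₚ.≤-Reasoning
    sep : A → A → ℕ
    sep = separations cs
    N = c * c′ ℕ.+ c′ * c
    X = h (length cs)
    N-max : ∀ e → let ℓ = count e xs; r = count (not ∘ e) xs in ℓ * r ℕ.+ r * ℓ ≤ N
    N-max e = let ℓ = count e xs; r = count (not ∘ e) xs
                  ℓr≤ = proj₁ (balanced {ℓ} {r} (≡.trans (count-not e xs) (≡.sym c+c′)) c′≤c c≤1+c′)
              in ℕₚ.+-mono-≤ ℓr≤ (≡.subst₂ _≤_ (ℕₚ.*-comm ℓ r) (ℕₚ.*-comm c c′) ℓr≤)
    pair-≤ : ∀ x y → length cs · h (sep x y) Q.≤ ∑ cs (λ e → separated e X x y)
    pair-≤ x y = begin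
      length cs · h t           ≡⟨ cong (_· h t) t+s ⟨
      (t ℕ.+ s) · h t           ≤⟨ h-chord t s ⟩
      t · h (t ℕ.+ s)           ≡⟨ cong (λ k → t · h k) t+s ⟩
      t · X                     ≡⟨ ∑-indicator (λ e → e x xor e y) cs X ⟨
      ∑ cs (λ e → separated e X x y) ∎
      where
      t = sep x y
      s = count (not ∘ (λ e → e x xor e y)) cs
      t+s : t ℕ.+ s ≡ length cs
      t+s = count-not (λ e → e x xor e y) cs
    scaled : length cs · ∑∑ xs xs (λ x y → h (sep x y)) Q.≤ length cs · (N · X)
    scaled = begin
      length cs · ∑∑ xs xs (λ x y → h (sep x y))              ≡⟨ ∑-· (length cs) xs _ ⟨
      ∑ xs (λ x → length cs · ∑ xs (λ y → h (sep x y)))       ≡⟨ ∑-cong xs (λ {x} _ → ∑-· (length cs) xs (λ y → h (sep x y))) ⟨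
      ∑∑ xs xs (λ x y → length cs · h (sep x y))              ≤⟨ ∑∑-mono xs xs (λ {x} {y} _ _ → pair-≤ x y) ⟩
      ∑∑ xs xs (λ x y → ∑ cs (λ e → separated e X x y))       ≡⟨ ∑-cong xs (λ {x} _ → ∑-swap xs cs (λ y e → separated e X x y)) ⟩
      ∑∑ xs cs (λ x e → ∑ xs (separated e X x))               ≡⟨ ∑-swap xs cs (λ x e → ∑ xs (separated e X x)) ⟩
      ∑ cs (λ e → ∑∑ xs xs (separated e X))                   ≤⟨ ∑-mono cs (λ {e} _ → ℚₚ.≤-trans (ℚₚ.≤-reflexive (∑-separated e xs X)) (·-monoˡ-≤ (h≥0 (length cs)) (N-max e))) ⟩
      ∑ cs (λ _ → N · X)                                      ≡⟨ ∑-const cs (N · X) ⟩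
      length cs · (N · X)                                     ∎
    -- Dividing by the number of bipartitions requires at least one. If there are none, K is a
    -- single vertex in the application and every term is h 0 = 0.
    cancel : ∀ cs′ → cs′ ≡ cs → ∑∑ xs xs (λ x y → h (sep x y)) Q.≤ N · X
    cancel (_ ∷ cs′) refl = ·-cancelˡ-≤ (length cs′) scaled
    cancel []        refl = begin
      ∑∑ xs xs (λ _ _ → h 0)    ≡⟨ ∑∑-cong xs xs (λ _ _ → ℚₚ.+-inverseʳ (f 2)) ⟩
      ∑∑ xs xs (λ _ _ → 0ℚ)     ≡⟨ ∑-cong xs (λ _ → zeros xs) ⟩
      ∑ xs (λ _ → 0ℚ)           ≡⟨ zeros xs ⟩
      0ℚ                        ≤⟨ ·-nonneg N (h≥0 0) ⟩
      N · h 0                   ∎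
      where
      zeros : ∀ (ys : List A) → ∑ ys (λ _ → 0ℚ) ≡ 0ℚ
      zeros []       = refl
      zeros (y ∷ ys) = ≡.trans (ℚₚ.+-identityˡ _) (zeros ys)

-- A connected dominating set from a vertex cover

count-++ : ∀ (q : A → Bool) xs ys → count q (xs ++ ys) ≡ count q xs ℕ.+ count q ys
count-++ q []       ys = refl
count-++ q (x ∷ xs) ys with q x
... | true  = cong suc (count-++ q xs ys)
... | false = count-++ q xs ys

count-↭ : ∀ (q : A → Bool) {xs ys} → xs ↭ ys → count q xs ≡ count q ys
count-↭ q Perm.refl = refl
count-↭ q (Perm.prep x σ) with q x
... | true  = cong suc (count-↭ q σ)
... | false = count-↭ q σ
count-↭ q (Perm.swap x y σ) with q x | q y
... | true  | true  = cong (suc ∘ suc) (count-↭ q σ)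
... | true  | false = cong suc (count-↭ q σ)
... | false | true  = cong suc (count-↭ q σ)
... | false | false = count-↭ q σ
count-↭ q (Perm.trans σ τ) = ≡.trans (count-↭ q σ) (count-↭ q τ)

count-witness : ∀ (q : A → Bool) xs → 0 ℕ.< count q xs → ∃ λ x → q x ≡ true
count-witness q (x ∷ xs) pos with q x in qx
... | true  = x , qx
... | false = count-witness q xs pos

nonempty : ∀ (xs : List A) → 0 ℕ.< length xs → ∃ (_∈ xs)
nonempty (x ∷ xs) _ = x , here refl

_∈?_ : ∀ {n} (v : Fin n) l → Dec (v ∈ l)
_∈?_ = DecMembership._∈?_ Fin._≟_

rest : ∀ {n} → List (Fin n) → List (Fin n)
rest {n} l = filter (λ v → ¬? (v ∈? l)) (allFin n)

∉-rest : ∀ {n} {l : List (Fin n)} {v} → v ∈ rest l → v ∉ l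
∉-rest {n} {l} v∈ = proj₂ (∈-filter⁻ (λ v → ¬? (v ∈? l)) {xs = allFin n} v∈)

split-↭ : ∀ {n} {l : List (Fin n)} → Unique l → allFin n ↭ l ++ rest l
split-↭ {n} {l} l! = same-elements⇒↭ (Unique.allFin⁺ n)
  (Unique.++⁺ l! (Unique.filter⁺ _ (Unique.allFin⁺ n)) (λ (v∈l , v∈rest) → ∉-rest v∈rest v∈l))
  (λ {v} _ → side v) (λ _ → ∈-allFin _)
  where
  side : ∀ v → v ∈ l ++ rest l
  side v with v ∈? l
  ... | yes v∈ = ∈-++⁺ˡ v∈
  ... | no  v∉ = ∈-++⁺ʳ l (∈-filter⁺ _ (∈-allFin v) v∉)

length-split : ∀ {n} {l : List (Fin n)} → Unique l → n ≡ length l ℕ.+ length (rest l)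
length-split {n} {l} l! = ≡.trans (≡.sym (length-tabulate {n = n} id))
  (≡.trans (↭-length (split-↭ l!)) (length-++ l))

module Skeleton {n} (G : Graph n) (conn : ∀ u v → ∃ λ k → Walk G k u v)
                (cov : Fin n → Bool)
                (covers : ∀ {u v} → adj G u v ≡ true → cov u ≡ false → cov v ≡ true) where
  open Growth G

  -- Equivalently, l has fewer vertices off the cover than on it. For a cover of size m this yields
  -- length at most 2m - 1.
  Thrifty : List (Fin n) → Set
  Thrifty l = suc (length l) ≤ 2 * count cov l

  -- A cover vertex raises the right side by 2 and the left side by 1, so l may fall short by one.
  -- That allowance starts the construction from the empty list and pays for the connecting vertex
  -- inserted by `extend`.
  thrifty-∷ : ∀ l {v} → cov v ≡ true → suc (length l) ≤ suc (2 * count cov l) → Thrifty (v ∷ l)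
  thrifty-∷ l cv le rewrite cv | ℕₚ.+-suc (count cov l) (count cov l ℕ.+ 0) = ℕ.s≤s le

  -- No two consecutive vertices of a walk miss the cover, so on a walk to l the last cover
  -- vertex off l is at distance at most 2 from l.
  extend : ∀ {l a} → Grown l → Thrifty l → a ∈ l → ∀ {k v} → Walk G k v a → cov v ≡ true → v ∉ l →
           ∃ λ l′ → Grown l′ × Thrifty l′ × length l ℕ.< length l′
  extend gr th a∈ stay cv v∉l = contradiction a∈ v∉l
  extend {l} gr th a∈ {v = v} (step {w = w} vw p) cv v∉l with w ∈? l | cov w in cw
  ... | yes w∈ | _    = v ∷ l , grow gr v∉l w∈ vw , thrifty-∷ l cv (ℕₚ.m≤n⇒m≤1+n th) , ℕₚ.≤-refl
  ... | no  w∉ | true = extend gr th a∈ p cw w∉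
  extend {l} gr th a∈ (step vw stay) cv v∉l | no w∉ | false = contradiction a∈ w∉
  extend {l} gr th a∈ {v = v} (step {w = w} vw (step {w = x} wx p)) cv v∉l | no w∉ | false with x ∈? l
  ... | no x∉  = extend gr th a∈ p (covers wx cw) x∉
  ... | yes x∈ = v ∷ w ∷ l , grow (grow gr w∉ x∈ wx) v∉wl (here refl) vw , thrifty-∷ (w ∷ l) cv th′ , ℕₚ.m≤n⇒m≤1+n ℕₚ.≤-refl
    where
    v∉wl : v ∉ w ∷ l
    v∉wl (here v≡w) = adj⇒≢ G vw v≡w
    v∉wl (there v∈) = v∉l v∈
    th′ : suc (suc (length l)) ≤ suc (2 * count cov (w ∷ l))
    th′ rewrite cw = ℕ.s≤s th

  grown-head : ∀ {l} → Grown l → ∃ (_∈ l)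
  grown-head (root v)       = v , here refl
  grown-head (grow _ _ _ _) = _ , here refl

  -- Every round lengthens a list without repetitions, whose length cannot exceed n; the fuel counts
  -- the rounds that remain possible.
  saturate : ∀ fuel {l} → n ≤ fuel ℕ.+ length l → Grown l → Thrifty l →
             ∃ λ l′ → Grown l′ × Thrifty l′ × (∀ v → cov v ≡ true → v ∈ l′)
  saturate fuel {l} enough gr th with any? (λ v → (cov v Bool.≟ true) ×-dec ¬? (v ∈? l))
  ... | no  all∈ = l , gr , th , λ v cv → decidable-stable (v ∈? l) (λ v∉ → all∈ (v , cv , v∉))
  saturate zero {l} enough gr th | yes (v , cv , v∉) = contradiction
    (subst (_≤ length l) (length-split {l = v ∷ l} (¬Any⇒All¬ l v∉ ∷ grown-unique gr)) enough)
    (ℕₚ.m+1+n≰m (length l) ∘ subst (_≤ length l) (≡.sym (ℕₚ.+-suc (length l) _)))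
  saturate (suc fuel) {l} enough gr th | yes (v , cv , v∉) =
    let a , a∈ = grown-head gr
        _ , gr′ , th′ , longer = extend gr th a∈ (proj₂ (conn v a)) cv v∉
    in saturate fuel (ℕₚ.≤-trans enough (ℕₚ.≤-trans (ℕₚ.≤-reflexive (≡.sym (ℕₚ.+-suc fuel (length l))))
                                                   (ℕₚ.+-monoʳ-≤ fuel longer))) gr′ th′

  -- A vertex off l is not in the cover, so the first step of any walk from it to l already lands in
  -- the cover, hence in l.
  dominated : ∀ {l} → Grown l → (∀ v → cov v ≡ true → v ∈ l) → ∀ {v} → v ∉ l → ∃ λ p → p ∈ l × adj G v p ≡ true
  dominated gr cov⊆ {v} v∉ with a , a∈ ← grown-head gr with conn v a
  ... | _ , stay = contradiction a∈ v∉
  ... | _ , step {w = w} vw _ with cov v in cv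
  ...   | true  = contradiction (cov⊆ v cv) v∉
  ...   | false = w , cov⊆ w (covers vw cv) , vw

  -- The saturated set may have fewer than k vertices, while the comparison with 𝒜 needs exactly k.
  -- Any vertex off l has a neighbour in l and can be appended, and k < n ensures that one is left.
  pad : ∀ j {l k} → length l ℕ.+ j ≡ k → k ℕ.< n → Grown l → (∀ v → cov v ≡ true → v ∈ l) →
        ∃ λ l′ → Grown l′ × length l′ ≡ k × (∀ v → cov v ≡ true → v ∈ l′)
  pad zero    {l} len k<n gr cov⊆ = l , gr , ≡.trans (≡.sym (ℕₚ.+-identityʳ _)) len , cov⊆
  pad (suc j) {l} {k} len k<n gr cov⊆ with nonempty (rest l) room
    where
    room : 0 ℕ.< length (rest l)
    room = ℕₚ.+-cancelˡ-< (length l) 0 _ (ℕₚ.≤-<-trans (ℕₚ.+-monoʳ-≤ (length l) ℕ.z≤n)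
             (subst (length l ℕ.+ suc j ℕ.<_) (length-split (grown-unique gr)) (subst (ℕ._< n) (≡.sym len) k<n)))
  ... | v , v∈ = let v∉ = ∉-rest v∈; _ , p∈ , vp = dominated gr cov⊆ v∉ in
    pad j (≡.trans (≡.sym (ℕₚ.+-suc (length l) j)) len) k<n (grow gr v∉ p∈ vp) (λ u cu → there (cov⊆ u cu))

  thrifty-length : ∀ {l k} → suc k ≡ 2 * count cov (allFin n) → Grown l → Thrifty l → length l ≤ k
  thrifty-length {l} sk gr th = ℕ.s≤s⁻¹ (ℕₚ.≤-trans th (subst (2 * count cov l ≤_) (≡.sym sk)
    (ℕₚ.*-monoʳ-≤ 2 (subst (count cov l ≤_)
      (≡.trans (≡.sym (count-++ cov l (rest l))) (≡.sym (count-↭ cov (split-↭ (grown-unique gr)))))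
      (ℕₚ.m≤m+n (count cov l) _)))))

  skeleton : ∀ {k} → suc k ≡ 2 * count cov (allFin n) → k ℕ.< n →
             ∃ λ l → Grown l × length l ≡ k × (∀ {v} → v ∉ l → ∃ λ p → p ∈ l × adj G v p ≡ true)
  skeleton {k} sk k<n with count-witness cov (allFin n) pos
    where
    pos : 0 ℕ.< count cov (allFin n)
    pos = ℕₚ.n≢0⇒n>0 λ none → contradiction (≡.trans sk (cong (2 *_) none)) λ ()
  ... | r , cr
    with l , gr , th , cov⊆ ← saturate n (ℕₚ.m≤m+n n 1) (root r) (thrifty-∷ [] cr ℕₚ.≤-refl)
    with l′ , gr′ , len , cov⊆′ ← pad (k ∸ length l) (ℕₚ.m+[n∸m]≡n (thrifty-length sk gr th)) k<n gr cov⊆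
    = l′ , gr′ , len , dominated gr′ cov⊆′

count-lookup : ∀ {n} (S : Subset n) → count (lookup S) (allFin n) ≡ ∣ S ∣
count-lookup []          = refl
count-lookup {suc n} (b ∷ S) = head b
  where
  tail : ∀ b → count (lookup (b ∷ S)) (Data.List.tabulate Fin.suc) ≡ ∣ S ∣
  tail b = ≡.trans (cong (count (lookup (b ∷ S))) (≡.sym (map-tabulate id Fin.suc)))
    (≡.trans (count-map (lookup (b ∷ S)) Fin.suc (allFin n)) (count-lookup S))
  head : ∀ b → count (lookup (b ∷ S)) (allFin (suc n)) ≡ ∣ b ∷ S ∣
  head true  = cong suc (tail true)
  head false = tail false

-- The upper bound

Consecutive : ℕ → ℕ → Set
Consecutive s t = suc s ≡ t ⊎ suc t ≡ s

-- The double sum for a double broom with 1 + e path vertices and c and c′ leaves: path with path,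
-- leaves with path in both orders, leaves with leaves. In the last part every ordered pair,
-- diagonal included, counts f 2, and pairs on opposite sides add the excess of f (2 + e) over f 2.
bound : (ℕ → ℚ) → ℕ → ℕ → ℕ → ℚ
bound f e c c′ = ∑∑-path f (suc e) + (L · F + L · F) +
                 (L · (L · f 2) + (c * c′ ℕ.+ c′ * c) · (f (2 ℕ.+ e) Q.- f 2))
  where
  L = c ℕ.+ c′
  F = ∑-path f (suc e)

module Parents {n} (G : Graph n) (K : List (Fin n))
               (dominated : ∀ {v} → v ∉ K → ∃ λ p → p ∈ K × adj G v p ≡ true) where

  O : List (Fin n)
  O = rest K

  -- The value v on K is a default; it makes `parent` total, so that bipartitions can be composed
  -- with it.
  parent : Fin n → Fin n
  parent v with v ∈? K
  ... | yes _  = v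
  ... | no  v∉ = proj₁ (dominated v∉)

  parent∈ : ∀ {v} → v ∉ K → parent v ∈ K
  parent∈ {v} v∉ with v ∈? K
  ... | yes v∈  = v∈
  ... | no  v∉′ = proj₁ (proj₂ (dominated v∉′))

  parent-adj : ∀ {v} → v ∉ K → adj G v (parent v) ≡ true
  parent-adj {v} v∉ with v ∈? K
  ... | yes v∈  = contradiction v∈ v∉
  ... | no  v∉′ = proj₂ (proj₂ (dominated v∉′))

module Dominated {n} (G : Graph n) {K : List (Fin n)} {e c c′ : ℕ}
                 (grown : Growth.Grown G K) (lengthK : length K ≡ suc e)
                 (dominated : ∀ {v} → v ∉ K → ∃ λ p → p ∈ K × adj G v p ≡ true)
                 (lengthO : c ℕ.+ c′ ≡ length (rest K)) (c′≤c : c′ ≤ c) (c≤1+c′ : c ≤ suc c′) where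
  open Growth G
  open Distance G

  open Parents G K dominated

  total-split : ∀ f → total f G ≡ ∑∑ K K (value f G) + (∑∑ O K (value f G) + ∑∑ O K (value f G)) + ∑∑ O O (value f G)
  total-split f = ≡.trans (∑∑-↭ (value f G) σ σ) (∑∑-++ K O (value-sym f G))
    where σ = split-↭ (grown-unique grown)

  module _ {f : ℕ → ℚ} (f-mono : ∀ k → f k Q.≤ f (suc k)) where

    KK-≤ : ∑∑ K K (value f G) Q.≤ ∑∑-path f (suc e)
    KK-≤ = subst (λ k → ∑∑ K K (value f G) Q.≤ ∑∑-path f k) lengthK (core-≤ grown f-mono)

    row-value : ∀ {o} → o ∈ O → ∑ K (value f G o) ≡ ∑ K (f ∘ d o)
    row-value o∈ = ∑-cong K (λ x∈ → value-≢ f G (λ { refl → ∉-rest o∈ x∈ }))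

    OK-row-≤ : ∀ {o} → o ∈ O → ∑ K (value f G o) Q.≤ ∑-path f (suc e)
    OK-row-≤ {o} o∈ = ℚₚ.≤-trans (ℚₚ.≤-reflexive (row-value o∈))
      (subst (λ k → ∑ K (f ∘ d o) Q.≤ ∑-path f k) lengthK
        (outer-row-≤ grown f-mono (parent∈ (∉-rest o∈)) (parent-adj (∉-rest o∈))))

    OK-const : ∑ O (λ _ → ∑-path f (suc e)) ≡ (c ℕ.+ c′) · ∑-path f (suc e)
    OK-const = ≡.trans (∑-const O _) (cong (_· ∑-path f (suc e)) (≡.sym lengthO))

    OK-≤ : ∑∑ O K (value f G) Q.≤ (c ℕ.+ c′) · ∑-path f (suc e)
    OK-≤ = ℚₚ.≤-trans (∑-mono O OK-row-≤) (ℚₚ.≤-reflexive OK-const)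

    OO-≤ : (∀ k → f (suc k) + f (suc k) Q.≤ f k + f (suc (suc k))) →
           ∑∑ O O (value f G) Q.≤
           (c ℕ.+ c′) · ((c ℕ.+ c′) · f 2) + (c * c′ ℕ.+ c′ * c) · (f (2 ℕ.+ e) Q.- f 2)
    OO-≤ f-convex with cs , len , sep ← cuts grown =
      ≡.subst₂ (λ L j → ∑∑ O O (value f G) Q.≤ L · (L · f 2) + (c * c′ ℕ.+ c′ * c) · (f (2 ℕ.+ j) Q.- f 2))
        (≡.sym lengthO) (≡.trans (length-map _ cs) (ℕₚ.suc-injective (≡.trans len lengthK)))
        (Outer.outer-≤ f f-mono f-convex O cs′ (value f G) pair lengthO c′≤c c≤1+c′)
      where
      -- Bipartitions of K are pulled back to O through the chosen neighbours; the two edges to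
      -- these neighbours account for the 2 in the bound below.
      cs′ = map (_∘ parent) cs
      pair : ∀ {x y} → x ∈ O → y ∈ O → value f G x y Q.≤ f (2 ℕ.+ separations cs′ x y)
      pair {x} {y} x∈ y∈ with x Fin.≟ y
      ... | yes _ = mono-≤ f-mono (ℕₚ.m≤m+n 2 _)
      ... | no  _ = mono-≤ f-mono (ℕₚ.≤-trans (d-step y (parent-adj (∉-rest x∈)))
                      (ℕ.s≤s (ℕₚ.≤-trans (d-stepʳ (parent x) (parent-adj (∉-rest y∈)))
                      (ℕ.s≤s (subst (d (parent x) (parent y) ≤_) (≡.sym (count-map _ (_∘ parent) cs))
                        (sep (parent∈ (∉-rest x∈)) (parent∈ (∉-rest y∈))))))))

    total-≤ : (∀ k → f (suc k) + f (suc k) Q.≤ f k + f (suc (suc k))) → total f G Q.≤ bound f e c c′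
    total-≤ f-convex = ℚₚ.≤-trans (ℚₚ.≤-reflexive (total-split f))
      (ℚₚ.+-mono-≤ (ℚₚ.+-mono-≤ KK-≤ (ℚₚ.+-mono-≤ OK-≤ OK-≤)) (OO-≤ f-convex))

-- Double brooms

path-types : ℕ → List ℕ
path-types k = map suc (downFrom k)

leaf-types : ℕ → ℕ → ℕ → List ℕ
leaf-types e c c′ = replicate c 0 ++ replicate c′ (2 ℕ.+ e)

∸-downFrom : ∀ k → map (k ∸_) (downFrom k) ↭ map suc (downFrom k)
∸-downFrom zero    = ↭-refl
∸-downFrom (suc k) = ↭-trans (map⁺ (suc k ∸_) (downFrom-suc k))
  (↭-prep (suc k) (↭-trans (↭-reflexive (≡.sym (map-∘ (downFrom k)))) (∸-downFrom k)))

typeValue : (ℕ → ℚ) → ℕ → ℕ → ℚ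
typeValue f s t = if does (s ℕ.≟ t) then f 2 else f ℕ.∣ s - t ∣

typeValue-≡ : ∀ f {s t} → s ≡ t → typeValue f s t ≡ f 2
typeValue-≡ f {s} {t} s≡t rewrite dec-true (s ℕ.≟ t) s≡t = refl

typeValue-≢ : ∀ f {s t} → s ≢ t → typeValue f s t ≡ f ℕ.∣ s - t ∣
typeValue-≢ f {s} {t} s≢t rewrite dec-false (s ℕ.≟ t) s≢t = refl

typeValue-sym : ∀ f s t → typeValue f s t ≡ typeValue f t s
typeValue-sym f s t with s ℕ.≟ t
... | yes refl = refl
... | no s≢t   = ≡.trans (typeValue-≢ f s≢t)
  (≡.trans (cong f (ℕₚ.∣-∣-comm s t)) (≡.sym (typeValue-≢ f (s≢t ∘ ≡.sym))))

top-row : ∀ f k → ∑ (path-types k) (typeValue f (suc k)) ≡ ∑-path f k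
top-row f k = begin
  ∑ (map suc (downFrom k)) (typeValue f (suc k))      ≡⟨ ∑-map suc (downFrom k) _ ⟩
  ∑ (downFrom k) (typeValue f (suc k) ∘ suc)          ≡⟨ ∑-cong (downFrom k) (λ i∈ → below (∈-downFrom⁻ i∈)) ⟩
  ∑ (downFrom k) (λ i → f (k ∸ i))                    ≡⟨ ∑-map (k ∸_) (downFrom k) f ⟨
  ∑ (map (k ∸_) (downFrom k)) f                       ≡⟨ ∑-↭ f (∸-downFrom k) ⟩
  ∑ (map suc (downFrom k)) f                          ≡⟨ ∑-map suc (downFrom k) f ⟩
  ∑-path f k                                          ∎
  where
  open ≡.≡-Reasoning
  below : ∀ {i} → i ℕ.< k → typeValue f (suc k) (suc i) ≡ f (k ∸ i)
  below {i} i<k = ≡.trans (typeValue-≢ f (ℕₚ.<⇒≢ i<k ∘ ≡.sym ∘ ℕₚ.suc-injective))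
    (cong f (≡.trans (ℕₚ.∣-∣-comm k i) (ℕₚ.m≤n⇒∣m-n∣≡n∸m (ℕₚ.<⇒≤ i<k))))

path-types-≡ : ∀ f k → ∑∑ (path-types k) (path-types k) (typeValue f) ≡ ∑∑-path f k
path-types-≡ f zero    = refl
path-types-≡ f (suc k) = ≡.trans (∑∑-∷ (suc k) (path-types k) (typeValue-sym f))
  (cong₂ _+_ (cong₂ (λ a b → a + (b + b)) (typeValue-≡ f {suc k} refl) (top-row f k)) (path-types-≡ f k))

count-replicate : ∀ (q : A → Bool) n x → count q (replicate n x) ≡ (if q x then n else 0)
count-replicate q zero x with q x
... | true  = refl
... | false = refl
count-replicate q (suc n) x with q x | count-replicate q n x
... | true  | eq = cong suc eq
... | false | eq = eq

∈-replicate : ∀ n {x y : A} → y ∈ replicate n x → y ≡ x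
∈-replicate (suc n) (here refl) = refl
∈-replicate (suc n) (there y∈)  = ∈-replicate n y∈

∈-leaf-types : ∀ {e} c c′ {s} → s ∈ leaf-types e c c′ → s ≡ 0 ⊎ s ≡ 2 ℕ.+ e
∈-leaf-types c c′ s∈ with ∈-++⁻ (replicate c 0) s∈
... | inj₁ s∈ˡ = inj₁ (∈-replicate c s∈ˡ)
... | inj₂ s∈ʳ = inj₂ (∈-replicate c′ s∈ʳ)

length-leaf-types : ∀ e c c′ → length (leaf-types e c c′) ≡ c ℕ.+ c′
length-leaf-types e c c′ = ≡.trans (length-++ (replicate c 0)) (cong₂ ℕ._+_ (length-replicate c) (length-replicate c′))

bound-≡ : ∀ f e c c′ → let V = path-types (suc e) ++ leaf-types e c c′ in
          ∑∑ V V (typeValue f) ≡ bound f e c c′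
bound-≡ f e c c′ = ≡.trans (∑∑-++ D E (typeValue-sym f))
  (cong₂ _+_ (cong₂ (λ a b → a + (b + b)) (path-types-≡ f (suc e)) leaf-path) leaf-leaf)
  where
  open ≡.≡-Reasoning
  D = path-types (suc e)
  E = leaf-types e c c′
  X = f (2 ℕ.+ e) Q.- f 2
  leaf-path : ∑∑ E D (typeValue f) ≡ (c ℕ.+ c′) · ∑-path f (suc e)
  leaf-path = begin
    ∑∑ E D (typeValue f)             ≡⟨ ∑-cong E (row ∘ ∈-leaf-types c c′) ⟩
    ∑ E (λ _ → ∑-path f (suc e))     ≡⟨ ∑-const E _ ⟩
    length E · ∑-path f (suc e)      ≡⟨ cong (_· ∑-path f (suc e)) (length-leaf-types e c c′) ⟩
    (c ℕ.+ c′) · ∑-path f (suc e)    ∎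
    where
    row : ∀ {s} → s ≡ 0 ⊎ s ≡ 2 ℕ.+ e → ∑ D (typeValue f s) ≡ ∑-path f (suc e)
    row (inj₁ refl) = ∑-map suc (downFrom (suc e)) (typeValue f 0)
    row (inj₂ refl) = top-row f (suc e)
  left : ℕ → Bool
  left s = does (s ℕ.≟ 0)
  far : f (2 ℕ.+ e) ≡ f 2 + X
  far = difference (f 2) (f (2 ℕ.+ e))
  pair : ∀ {s t} → s ≡ 0 ⊎ s ≡ 2 ℕ.+ e → t ≡ 0 ⊎ t ≡ 2 ℕ.+ e → typeValue f s t ≡ f 2 + separated left X s t
  pair (inj₁ refl) (inj₁ refl) = ≡.sym (ℚₚ.+-identityʳ (f 2))
  pair (inj₁ refl) (inj₂ refl) = far
  pair (inj₂ refl) (inj₁ refl) = far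
  pair (inj₂ refl) (inj₂ refl) rewrite dec-true (e ℕ.≟ e) refl = ≡.sym (ℚₚ.+-identityʳ (f 2))
  count-left : count left E ≡ c
  count-left = ≡.trans (count-++ left (replicate c 0) _)
    (≡.trans (cong₂ ℕ._+_ (count-replicate left c 0) (count-replicate left c′ (2 ℕ.+ e))) (ℕₚ.+-identityʳ c))
  count-right : count (not ∘ left) E ≡ c′
  count-right = ≡.trans (count-++ (not ∘ left) (replicate c 0) _)
    (cong₂ ℕ._+_ (count-replicate (not ∘ left) c 0) (count-replicate (not ∘ left) c′ (2 ℕ.+ e)))
  leaf-leaf : ∑∑ E E (typeValue f) ≡ (c ℕ.+ c′) · ((c ℕ.+ c′) · f 2) + (c * c′ ℕ.+ c′ * c) · X
  leaf-leaf = begin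
    ∑∑ E E (typeValue f)                                    ≡⟨ ∑∑-cong E E (λ s∈ t∈ → pair (∈-leaf-types c c′ s∈) (∈-leaf-types c c′ t∈)) ⟩
    ∑∑ E E (λ s t → f 2 + separated left X s t)             ≡⟨ ∑∑-separated (f 2) E left X ⟩
    length E · (length E · f 2) + (count left E * count (not ∘ left) E ℕ.+ count (not ∘ left) E * count left E) · X
      ≡⟨ cong₂ _+_ (cong (λ L → L · (L · f 2)) (length-leaf-types e c c′))
                   (cong₂ (λ ℓ r → (ℓ * r ℕ.+ r * ℓ) · X) count-left count-right) ⟩
    (c ℕ.+ c′) · ((c ℕ.+ c′) · f 2) + (c * c′ ℕ.+ c′ * c) · X ∎

-- The types label the vertices of a double broom from end to end: 0 and 2 + e for the leaves
-- on either side, 1, …, 1 + e for the vertices of the path.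
module Typed {n} (H : Graph n) {e c c′ : ℕ} (τ : Fin n → ℕ)
             (adj⇒consecutive : ∀ {u v} → adj H u v ≡ true → Consecutive (τ u) (τ v))
             (τ-types : map τ (allFin n) ↭ path-types (suc e) ++ leaf-types e c c′)
             (τ≤ : ∀ u → τ u ≤ 2 ℕ.+ e) (fits : 2 ℕ.+ e ≤ n) where
  open Distance H

  -- An edge changes the type by exactly one, so differences of types bound walk lengths from below.
  -- This is the direction required for 𝒜 to reach `bound`.
  walk-≤ : ∀ {k u v} → Walk H k u v → ℕ.∣ τ u - τ v ∣ ≤ k
  walk-≤ {k} {u} stay = subst (_≤ k) (≡.sym (ℕₚ.∣n-n∣≡0 (τ u))) ℕ.z≤n
  walk-≤ {u = u} {v = v} (step {w = w} a p) = ℕₚ.≤-trans (ℕₚ.∣-∣-triangle (τ u) (τ w) (τ v))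
    (ℕₚ.+-mono-≤ (ℕₚ.≤-reflexive (one (τ u) (τ w) (adj⇒consecutive a))) (walk-≤ p))
    where
    one : ∀ s t → Consecutive s t → ℕ.∣ s - t ∣ ≡ 1
    one s t (inj₁ refl) = ≡.trans (cong (ℕ.∣ s -_∣) (≡.sym (ℕₚ.+-comm s 1))) (ℕₚ.∣m-m+n∣≡n s 1)
    one s t (inj₂ refl) = ≡.trans (ℕₚ.∣-∣-comm (suc t) t)
      (≡.trans (cong (ℕ.∣ t -_∣) (≡.sym (ℕₚ.+-comm t 1))) (ℕₚ.∣m-m+n∣≡n t 1))

  value-≥ : ∀ {f} → (∀ k → f k Q.≤ f (suc k)) → ∀ u v → typeValue f (τ u) (τ v) Q.≤ value f H u v
  value-≥ {f} f-mono u v with u Fin.≟ v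
  ... | yes refl = ℚₚ.≤-reflexive (typeValue-≡ f {τ u} refl)
  ... | no  u≢v with τ u ℕ.≟ τ v
  ...   | no  τu≢τv = ℚₚ.≤-trans (ℚₚ.≤-reflexive (typeValue-≢ f τu≢τv)) (mono-≤ f-mono (d-≥ (ℕₚ.≤-trans (ℕₚ.∣m-n∣≤m⊔n (τ u) (τ v))
                        (ℕₚ.≤-trans (ℕₚ.⊔-lub (τ≤ u) (τ≤ v)) fits)) walk-≤))
  -- A type is not consecutive to itself, so distinct vertices of the same type are not adjacent and
  -- are at distance at least 2.
  ...   | yes τu≡τv = ℚₚ.≤-trans (ℚₚ.≤-reflexive (typeValue-≡ f τu≡τv)) (mono-≤ f-mono (d-≥ (ℕₚ.≤-trans (ℕₚ.m≤m+n 2 e) fits) two))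
    where
    two : ∀ {k} → Walk H k u v → 2 ≤ k
    two stay                = contradiction refl u≢v
    two (step _ (step _ _)) = ℕ.s≤s (ℕ.s≤s ℕ.z≤n)
    two (step a stay) with adj⇒consecutive a
    ... | inj₁ eq = contradiction (≡.trans eq (≡.sym τu≡τv)) ℕₚ.1+n≢n
    ... | inj₂ eq = contradiction (≡.trans eq τu≡τv) ℕₚ.1+n≢n

  total-≥ : ∀ {f} → (∀ k → f k Q.≤ f (suc k)) → bound f e c c′ Q.≤ total f H
  total-≥ {f} f-mono = begin
    bound f e c c′                                    ≡⟨ bound-≡ f e c c′ ⟨
    ∑∑ T T (typeValue f)                              ≡⟨ ∑∑-↭ (typeValue f) τ-types τ-types ⟨
    ∑∑ (map τ V) (map τ V) (typeValue f)              ≡⟨ ∑∑-map τ V V (typeValue f) ⟩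
    ∑∑ V V (λ u v → typeValue f (τ u) (τ v))          ≤⟨ ∑∑-mono V V (λ {u} {v} _ _ → value-≥ f-mono u v) ⟩
    total f H                                         ∎
    where
    open ℚₚ.≤-Reasoning
    V = allFin n
    T = path-types (suc e) ++ leaf-types e c c′

-- The extremal tree as a double broom

m+m≡m*2 : ∀ m → m ℕ.+ m ≡ m * 2
m+m≡m*2 m = ≡.trans (cong (m ℕ.+_) (≡.sym (ℕₚ.+-identityʳ m))) (ℕₚ.*-comm 2 m)

-- Halving suc L rounds L / 2 up, as in the leaf count of 𝒜: remainder 1 means that L is even,
-- remainder 0 that the left part has one more.
half : ∀ L → ∃ λ c′ → suc L ℕ./ 2 ℕ.+ c′ ≡ L × c′ ≤ suc L ℕ./ 2 × suc L ℕ./ 2 ≤ suc c′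
half L with suc L ℕ./ 2 | suc L ℕ.% 2 | m≡m%n+[m/n]*n (suc L) 2 | m%n<n (suc L) 2
... | c     | 1 | eq | _ = c , ≡.trans (m+m≡m*2 c) (≡.sym (ℕₚ.suc-injective eq)) , ℕₚ.≤-refl , ℕₚ.n≤1+n c
... | suc c | 0 | eq | _ = c , ≡.trans (cong suc (m+m≡m*2 c)) (≡.sym (ℕₚ.suc-injective eq)) , ℕₚ.n≤1+n c , ℕₚ.≤-refl
... | _     | suc (suc _) | _ | ℕ.s≤s (ℕ.s≤s ())

holds : ∀ {P : Set} (P? : Dec P) → does P? ≡ true → P
holds (yes p) _ = p

∨-true : ∀ a {b} → a ∨ b ≡ true → a ≡ true ⊎ b ≡ true
∨-true true  _  = inj₁ refl
∨-true false bt = inj₂ bt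

broomType : ℕ → ℕ → ℕ → ℕ
broomType e c i = if i ℕ.<ᵇ suc e then suc i else (if i ℕ.<ᵇ suc e ℕ.+ c then 0 else 2 ℕ.+ e)

module _ (e c : ℕ) where

  on-path : ∀ {i} → i ℕ.< suc e → broomType e c i ≡ suc i
  on-path {i} i≤e rewrite dec-true (i ℕ.<? suc e) i≤e = refl

  on-left : ∀ {i} → suc e ≤ i → i ℕ.< suc e ℕ.+ c → broomType e c i ≡ 0
  on-left {i} e<i i<
    rewrite dec-false (i ℕ.<? suc e) (ℕₚ.≤⇒≯ e<i) | dec-true (i ℕ.<? suc e ℕ.+ c) i< = refl

  on-right : ∀ {i} → suc e ℕ.+ c ≤ i → broomType e c i ≡ 2 ℕ.+ e
  on-right {i} i≥
    rewrite dec-false (i ℕ.<? suc e) (ℕₚ.≤⇒≯ (ℕₚ.≤-trans (ℕₚ.m≤m+n (suc e) c) i≥))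
          | dec-false (i ℕ.<? suc e ℕ.+ c) (ℕₚ.≤⇒≯ i≥) = refl

  data Position (i : ℕ) : Set where
    path  : i ℕ.< suc e → Position i
    left  : suc e ≤ i → i ℕ.< suc e ℕ.+ c → Position i
    right : suc e ℕ.+ c ≤ i → Position i

  position : ∀ i → Position i
  position i with i ℕ.<? suc e | i ℕ.<? suc e ℕ.+ c
  ... | yes i≤e | _      = path i≤e
  ... | no  i≰e | yes i< = left (ℕₚ.≮⇒≥ i≰e) i<
  ... | no  _   | no  i≮ = right (ℕₚ.≮⇒≥ i≮)

  broomType-≤ : ∀ i → broomType e c i ≤ 2 ℕ.+ e
  broomType-≤ i with position i
  ... | path i≤e     rewrite on-path i≤e = ℕₚ.m≤n⇒m≤1+n i≤e
  ... | left e<i i<  rewrite on-left e<i i< = ℕ.z≤n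
  ... | right i≥     rewrite on-right i≥ = ℕₚ.≤-refl

  map-block : ∀ (t : ℕ → ℕ) {x} j b → (∀ {i} → b ≤ i → i ℕ.< j ℕ.+ b → t i ≡ x) →
              map t (downFrom (j ℕ.+ b)) ≡ replicate j x ++ map t (downFrom b)
  map-block t zero    b t≡x = refl
  map-block t (suc j) b t≡x = cong₂ _∷_ (t≡x (ℕₚ.m≤n+m b j) ℕₚ.≤-refl)
    (map-block t j b (λ b≤i i< → t≡x b≤i (ℕₚ.m≤n⇒m≤1+n i<)))

  broomTypes : ∀ c′ → map (broomType e c) (downFrom (suc e ℕ.+ (c ℕ.+ c′))) ↭ path-types (suc e) ++ leaf-types e c c′
  broomTypes c′ = begin
    map t (downFrom (suc e ℕ.+ (c ℕ.+ c′)))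
      ≡⟨ cong (map t ∘ downFrom) reorder ⟩
    map t (downFrom (c′ ℕ.+ (c ℕ.+ suc e)))
      ≡⟨ map-block t c′ (c ℕ.+ suc e) (λ {i} b≤i _ → on-right (subst (_≤ i) (ℕₚ.+-comm c (suc e)) b≤i)) ⟩
    R ++ map t (downFrom (c ℕ.+ suc e))
      ≡⟨ cong (R ++_) (map-block t c (suc e) (λ {i} b≤i i< → on-left b≤i (subst (i ℕ.<_) (ℕₚ.+-comm c (suc e)) i<))) ⟩
    R ++ L ++ map t (downFrom (suc e))
      ≡⟨ cong (λ P → R ++ L ++ P) (map-path (suc e) (λ i<e → on-path i<e)) ⟩
    R ++ L ++ P
      ↭⟨ ++-comm R (L ++ P) ⟩
    (L ++ P) ++ R
      ↭⟨ ++⁺ʳ R (++-comm L P) ⟩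
    (P ++ L) ++ R
      ≡⟨ ++-assoc P L R ⟩
    P ++ L ++ R
      ∎
    where
    open Perm.PermutationReasoning
    t = broomType e c
    P = path-types (suc e)
    L = replicate c 0
    R = replicate c′ (2 ℕ.+ e)
    reorder : suc e ℕ.+ (c ℕ.+ c′) ≡ c′ ℕ.+ (c ℕ.+ suc e)
    reorder = ≡.trans (≡.sym (ℕₚ.+-assoc (suc e) c c′))
      (≡.trans (ℕₚ.+-comm (suc e ℕ.+ c) c′) (cong (c′ ℕ.+_) (ℕₚ.+-comm (suc e) c)))
    map-path : ∀ k → (∀ {i} → i ℕ.< k → t i ≡ suc i) → map t (downFrom k) ≡ map suc (downFrom k)
    map-path zero    _  = refl
    map-path (suc k) eq = cong₂ _∷_ (eq ℕₚ.≤-refl) (map-path k (λ i< → eq (ℕₚ.m≤n⇒m≤1+n i<)))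

map-toℕ-allFin : ∀ n → map toℕ (allFin n) ↭ downFrom n
map-toℕ-allFin n = ↭-trans (↭-reflexive (≡.trans (map-tabulate id toℕ) (tabulate≡ n id)))
  (↭-trans (↭-sym (↭-reverse (upTo n))) (↭-reflexive (reverse-upTo n)))
  where
  tabulate≡ : ∀ n (h : ℕ → ℕ) → Data.List.tabulate {n = n} (h ∘ toℕ) ≡ Data.List.applyUpTo h n
  tabulate≡ zero    h = refl
  tabulate≡ (suc n) h = cong (h 0 ∷_) (tabulate≡ n (h ∘ suc))

consecutive-irrefl : ∀ {s t} → s ≡ t → ¬ Consecutive s t
consecutive-irrefl refl (inj₁ eq) = ℕₚ.1+n≢n eq
consecutive-irrefl refl (inj₂ eq) = ℕₚ.1+n≢n eq

module Broom (n m : ℕ) where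

  private
    e c : ℕ
    e = 2 * m ∸ 2
    c = (n ℕ.+ 2 ∸ 2 * m) ℕ./ 2

    inner outerˡ outerʳ : ℕ → ℕ → Bool
    inner  i j = (suc i ℕ.≡ᵇ j) ∧ (j ℕ.≤ᵇ e)
    outerˡ i j = (e ℕ.<ᵇ j) ∧ (j ℕ.<ᵇ suc e ℕ.+ c) ∧ (i ℕ.≡ᵇ 0)
    outerʳ i j = (suc e ℕ.+ c ℕ.≤ᵇ j) ∧ (i ℕ.≡ᵇ e)

  edge⇒consecutive : ∀ i j → edgeA n m i j ≡ true → Consecutive (broomType e c i) (broomType e c j)
  edge⇒consecutive i j edge with ∨-true (inner i j) edge
  ... | inj₁ p with ij , j≤e ← ∧-true {suc i ℕ.≡ᵇ j} p
    with refl ← holds (suc i ℕ.≟ j) ij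
    rewrite on-path e c (ℕ.s≤s (holds (suc i ℕ.≤? e) j≤e))
          | on-path e c (ℕₚ.m≤n⇒m≤1+n (holds (suc i ℕ.≤? e) j≤e)) = inj₁ refl
  ... | inj₂ q with ∨-true (outerˡ i j) q
  ...   | inj₁ l with e<j , l′ ← ∧-true {e ℕ.<ᵇ j} l with j< , i≡0 ← ∧-true {j ℕ.<ᵇ suc e ℕ.+ c} l′
    with refl ← holds (i ℕ.≟ 0) i≡0
    rewrite on-left e c (holds (e ℕ.<? j) e<j) (holds (j ℕ.<? suc e ℕ.+ c) j<)
          | on-path e c {0} (ℕ.s≤s ℕ.z≤n) = inj₂ refl
  ...   | inj₂ r with j≥ , i≡e ← ∧-true {suc e ℕ.+ c ℕ.≤ᵇ j} r
    with refl ← holds (i ℕ.≟ e) i≡e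
    rewrite on-right e c (holds (suc e ℕ.+ c ℕ.≤? j) j≥) | on-path e c {e} ℕₚ.≤-refl = inj₁ refl

  path-edge : ∀ {i j} → suc i ≡ j → j ≤ e → edgeA n m i j ≡ true
  path-edge {i} {j} ij j≤e rewrite dec-true (suc i ℕ.≟ j) ij | dec-true (j ℕ.≤? e) j≤e = refl

  left-edge : ∀ {i j} → suc e ≤ j → j ℕ.< suc e ℕ.+ c → i ≡ 0 → edgeA n m i j ≡ true
  left-edge {i} {j} e<j j< i≡0
    rewrite dec-true (e ℕ.<? j) e<j | dec-true (j ℕ.<? suc e ℕ.+ c) j< | dec-true (i ℕ.≟ 0) i≡0 = ∨-zeroʳ _

  right-edge : ∀ {i j} → suc e ℕ.+ c ≤ j → i ≡ e → edgeA n m i j ≡ true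
  right-edge {i} {j} j≥ i≡e
    rewrite dec-true (suc e ℕ.+ c ℕ.≤? j) j≥ | dec-true (i ℕ.≟ e) i≡e
    = ≡.trans (cong (inner i j ∨_) (∨-zeroʳ (outerˡ i j))) (∨-zeroʳ (inner i j))

  consecutive⇒edge : ∀ i j → Consecutive (broomType e c i) (broomType e c j) →
                     edgeA n m i j ≡ true ⊎ edgeA n m j i ≡ true
  consecutive⇒edge i j con with position e c i | position e c j
  ... | path i≤e | path j≤e rewrite on-path e c i≤e | on-path e c j≤e with con
  ...   | inj₁ eq = inj₁ (path-edge (ℕₚ.suc-injective eq) (ℕ.s≤s⁻¹ j≤e))
  ...   | inj₂ eq = inj₂ (path-edge (ℕₚ.suc-injective eq) (ℕ.s≤s⁻¹ i≤e))
  consecutive⇒edge i j con | path i≤e | left e<j j< rewrite on-path e c i≤e | on-left e c e<j j< with con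
  ...   | inj₂ eq = inj₁ (left-edge e<j j< (ℕₚ.suc-injective (≡.sym eq)))
  consecutive⇒edge i j con | path i≤e | right j≥ rewrite on-path e c i≤e | on-right e c j≥ with con
  ...   | inj₁ refl = inj₁ (right-edge j≥ refl)
  ...   | inj₂ refl = contradiction i≤e (ℕₚ.≤⇒≯ (ℕₚ.m≤n+m (suc e) 1))
  consecutive⇒edge i j con | left e<i i< | path j≤e rewrite on-left e c e<i i< | on-path e c j≤e with con
  ...   | inj₁ eq = inj₂ (left-edge e<i i< (ℕₚ.suc-injective (≡.sym eq)))
  consecutive⇒edge i j con | right i≥ | path j≤e rewrite on-right e c i≥ | on-path e c j≤e with con
  ...   | inj₁ refl = contradiction j≤e (ℕₚ.≤⇒≯ (ℕₚ.m≤n+m (suc e) 1))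
  ...   | inj₂ refl = inj₂ (right-edge i≥ refl)
  consecutive⇒edge i j con | left e<i i< | left e<j j<
    rewrite on-left e c e<i i< | on-left e c e<j j< with inj₁ () ← con
  consecutive⇒edge i j con | left e<i i< | right j≥
    rewrite on-left e c e<i i< | on-right e c j≥ with inj₁ () ← con
  consecutive⇒edge i j con | right i≥ | left e<j j<
    rewrite on-right e c i≥ | on-left e c e<j j< with inj₁ () ← con
  consecutive⇒edge i j con | right i≥ | right j≥
    rewrite on-right e c i≥ | on-right e c j≥ with con
  ...   | inj₁ eq = contradiction eq ℕₚ.1+n≢n
  ...   | inj₂ eq = contradiction eq ℕₚ.1+n≢n

  τ : Fin n → ℕ
  τ u = broomType e c (toℕ u)

  adj⇒consecutive : ∀ {u v} → adj (𝒜 n m) u v ≡ true → Consecutive (τ u) (τ v)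
  adj⇒consecutive {u} {v} a with ∨-true _ (proj₂ (∧-true {not (toℕ u ℕ.≡ᵇ toℕ v)} a))
  ... | inj₁ uv = edge⇒consecutive (toℕ u) (toℕ v) uv
  ... | inj₂ vu with edge⇒consecutive (toℕ v) (toℕ u) vu
  ...   | inj₁ eq = inj₂ eq
  ...   | inj₂ eq = inj₁ eq

  consecutive⇒adj : ∀ {u v} → Consecutive (τ u) (τ v) → adj (𝒜 n m) u v ≡ true
  consecutive⇒adj {u} {v} con
    rewrite dec-false (toℕ u ℕ.≟ toℕ v) (λ eq → consecutive-irrefl (cong (broomType e c) eq) con)
    with consecutive⇒edge (toℕ u) (toℕ v) con
  ... | inj₁ uv rewrite uv = refl
  ... | inj₂ vu rewrite vu = ∨-zeroʳ _

  τ-≤ : ∀ u → τ u ≤ 2 ℕ.+ e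
  τ-≤ u = broomType-≤ e c (toℕ u)

  τ-types : ∀ {c′} → n ≡ suc e ℕ.+ (c ℕ.+ c′) → map τ (allFin n) ↭ path-types (suc e) ++ leaf-types e c c′
  τ-types {c′} n≡ = ↭-trans (↭-reflexive (map-∘ (allFin n)))
    (↭-trans (map⁺ (broomType e c) (map-toℕ-allFin n))
      (subst (λ k → map (broomType e c) (downFrom k) ↭ path-types (suc e) ++ leaf-types e c c′) (≡.sym n≡) (broomTypes e c c′)))

-- Isomorphism of double brooms

TypedBy : ∀ {n} → Graph n → (Fin n → ℕ) → Set
TypedBy G a = ∀ u v → (adj G u v ≡ true → Consecutive (a u) (a v)) × (Consecutive (a u) (a v) → adj G u v ≡ true)

-- A permutation of the two label lists carries a bijection of their positions, and positions are
-- vertices; the casts only identify the list lengths with n.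
↭⇒bijection : ∀ {n} (a b : Fin n → ℕ) → map a (allFin n) ↭ map b (allFin n) →
              ∃ λ (φ : Fin n ↔ Fin n) → ∀ u → a u ≡ b (Inverse.to φ u)
↭⇒bijection {n} a b σ = φ , λ u → begin
  a u                                             ≡⟨ lookup-tabulate a u ⟨
  Data.List.lookup as (Fin.cast (≡.sym |as|) u)   ≡⟨ SetoidPermₚ.onIndices-lookup (≡.setoid ℕ) σ′ (Fin.cast (≡.sym |as|) u) ⟩
  Data.List.lookup bs (move u)                    ≡⟨ cong (Data.List.lookup bs) (cast-involutive (≡.sym |bs|) |bs| (move u)) ⟨
  Data.List.lookup bs (Fin.cast (≡.sym |bs|) (Inverse.to φ u))  ≡⟨ lookup-tabulate b (Inverse.to φ u) ⟩
  b (Inverse.to φ u)                              ∎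
  where
  open ≡.≡-Reasoning
  as = Data.List.tabulate a
  bs = Data.List.tabulate b
  |as| = length-tabulate a
  |bs| = length-tabulate b
  σ′ = Perm.↭⇒↭ₛ (≡.subst₂ _↭_ (map-tabulate id a) (map-tabulate id b) σ)
  indices = onIndices σ′
  move : Fin n → Fin (length bs)
  move u = Inverse.to indices (Fin.cast (≡.sym |as|) u)
  φ : Fin n ↔ Fin n
  φ = FinPerm.cast-id (≡.sym |as|) FinPerm.∘ₚ indices FinPerm.∘ₚ FinPerm.cast-id |bs|

-- Adjacency depends only on the types, so any bijection that preserves types is an isomorphism.
typed-iso : ∀ {n} {G H : Graph n} {a b} → TypedBy G a → TypedBy H b →
            map a (allFin n) ↭ map b (allFin n) → G ≅ H
typed-iso {G = G} {H} {a} {b} G-typed H-typed σ =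
  let φ , a≡b = ↭⇒bijection a b σ in
  φ , λ u v → let u′ = Inverse.to φ u; v′ = Inverse.to φ v in ⇔→≡ (mk⇔
    (λ uv → proj₂ (H-typed u′ v′) (≡.subst₂ Consecutive (a≡b u) (a≡b v) (proj₁ (G-typed u v) uv)))
    (λ uv → proj₂ (G-typed u v) (≡.subst₂ Consecutive (≡.sym (a≡b u)) (≡.sym (a≡b v)) (proj₁ (H-typed u′ v′) uv))))

-- A typing is not canonical: a broom can be reflected, and the two kinds of leaves of a star can be
-- merged. Both changes respect consecutiveness only in the range of types that occur, which M
-- bounds.
relabel : ∀ {n} {G : Graph n} {a M} (q : ℕ → ℕ) →
          (∀ {s t} → s ≤ M → t ≤ M → Consecutive s t → Consecutive (q s) (q t)) →
          (∀ {s t} → s ≤ M → t ≤ M → Consecutive (q s) (q t) → Consecutive s t) →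
          (∀ u → a u ≤ M) → TypedBy G a → TypedBy G (q ∘ a)
relabel q to from a≤ typed u v =
  (to (a≤ u) (a≤ v) ∘ proj₁ (typed u v)) , (proj₂ (typed u v) ∘ from (a≤ u) (a≤ v))

consecutive-sym : ∀ {s t} → Consecutive s t → Consecutive t s
consecutive-sym (inj₁ eq) = inj₂ eq
consecutive-sym (inj₂ eq) = inj₁ eq

∸-consecutive : ∀ {M s t} → s ≤ M → t ≤ M → Consecutive s t → Consecutive (M ∸ s) (M ∸ t)
∸-consecutive {M} s≤ t≤ (inj₁ refl) = inj₂ (≡.sym (ℕₚ.+-∸-assoc 1 t≤))
∸-consecutive {M} s≤ t≤ (inj₂ refl) = inj₁ (≡.sym (ℕₚ.+-∸-assoc 1 s≤))

∸-consecutive⁻ : ∀ {M s t} → s ≤ M → t ≤ M → Consecutive (M ∸ s) (M ∸ t) → Consecutive s t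
∸-consecutive⁻ {M} {s} {t} s≤ t≤ con = ≡.subst₂ Consecutive (ℕₚ.m∸[m∸n]≡n s≤) (ℕₚ.m∸[m∸n]≡n t≤)
  (∸-consecutive (ℕₚ.m∸n≤m M s) (ℕₚ.m∸n≤m M t) con)

mirror : ∀ e ℓ r → map (2 ℕ.+ e ∸_) (path-types (suc e) ++ leaf-types e ℓ r) ↭
         path-types (suc e) ++ leaf-types e r ℓ
mirror e ℓ r = ↭-trans (↭-reflexive (map-++ M (path-types (suc e)) (leaf-types e ℓ r)))
  (↭-trans (++⁺ʳ _ (↭-trans (↭-reflexive (≡.sym (map-∘ (downFrom (suc e))))) (∸-downFrom (suc e))))
    (++⁺ˡ (path-types (suc e)) (↭-trans (↭-reflexive (≡.trans (map-++ M (replicate ℓ 0) (replicate r (2 ℕ.+ e)))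
        (cong₂ _++_ (map-replicate M ℓ 0) (≡.trans (map-replicate M r (2 ℕ.+ e)) (cong (replicate r) (ℕₚ.n∸n≡0 e))))))
      (++-comm (replicate ℓ (2 ℕ.+ e)) (replicate r 0)))))
  where
  M : ℕ → ℕ
  M = 2 ℕ.+ e ∸_

-- When the path is a single vertex, both kinds of leaves hang from it.
collapse : ℕ → ℕ
collapse (suc (suc _)) = 0
collapse t             = t

collapse-consecutive : ∀ {s t} → s ≤ 2 → t ≤ 2 → Consecutive s t → Consecutive (collapse s) (collapse t)
collapse-consecutive {0} s≤ t≤ (inj₁ refl) = inj₁ refl
collapse-consecutive {1} s≤ t≤ (inj₁ refl) = inj₂ refl
collapse-consecutive {suc (suc _)} s≤ (ℕ.s≤s (ℕ.s≤s ())) (inj₁ refl)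
collapse-consecutive {t = 0} s≤ t≤ (inj₂ refl) = inj₂ refl
collapse-consecutive {t = 1} s≤ t≤ (inj₂ refl) = inj₁ refl
collapse-consecutive {t = suc (suc _)} (ℕ.s≤s (ℕ.s≤s ())) t≤ (inj₂ refl)

collapse-consecutive⁻ : ∀ {s t} → s ≤ 2 → t ≤ 2 → Consecutive (collapse s) (collapse t) → Consecutive s t
collapse-consecutive⁻ {0} {1} s≤ t≤ con = con
collapse-consecutive⁻ {1} {0} s≤ t≤ con = con
collapse-consecutive⁻ {1} {suc (suc zero)} s≤ t≤ con = inj₁ refl
collapse-consecutive⁻ {suc (suc zero)} {1} s≤ t≤ con = inj₂ refl
collapse-consecutive⁻ {0} {0} s≤ t≤ (inj₁ ())
collapse-consecutive⁻ {0} {0} s≤ t≤ (inj₂ ())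
collapse-consecutive⁻ {0} {suc (suc _)} s≤ t≤ (inj₁ ())
collapse-consecutive⁻ {0} {suc (suc _)} s≤ t≤ (inj₂ ())
collapse-consecutive⁻ {1} {1} s≤ t≤ (inj₁ ())
collapse-consecutive⁻ {1} {1} s≤ t≤ (inj₂ ())
collapse-consecutive⁻ {suc (suc _)} {0} s≤ t≤ (inj₁ ())
collapse-consecutive⁻ {suc (suc _)} {0} s≤ t≤ (inj₂ ())
collapse-consecutive⁻ {suc (suc _)} {suc (suc _)} s≤ t≤ (inj₁ ())
collapse-consecutive⁻ {suc (suc _)} {suc (suc _)} s≤ t≤ (inj₂ ())
collapse-consecutive⁻ {suc (suc (suc _))} {1} (ℕ.s≤s (ℕ.s≤s ())) t≤ con
collapse-consecutive⁻ {1} {suc (suc (suc _))} s≤ (ℕ.s≤s (ℕ.s≤s ())) con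

collapse-types : ∀ c c′ → map collapse (path-types 1 ++ leaf-types 0 c c′) ≡ path-types 1 ++ leaf-types 0 (c ℕ.+ c′) 0
collapse-types c c′ = cong (1 ∷_) (begin
  map collapse (replicate c 0 ++ replicate c′ 2)                    ≡⟨ map-++ collapse (replicate c 0) (replicate c′ 2) ⟩
  map collapse (replicate c 0) ++ map collapse (replicate c′ 2)     ≡⟨ cong₂ _++_ (map-replicate collapse c 0) (map-replicate collapse c′ 2) ⟩
  replicate c 0 ++ replicate c′ 0                                   ≡⟨ replicate-+ c ⟩
  replicate (c ℕ.+ c′) 0                                            ≡⟨ ++-identityʳ _ ⟨
  replicate (c ℕ.+ c′) 0 ++ []                                      ∎)
  where
  open ≡.≡-Reasoning
  replicate-+ : ∀ c → replicate c 0 ++ replicate c′ 0 ≡ replicate (c ℕ.+ c′) 0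
  replicate-+ zero    = refl
  replicate-+ (suc c) = cong (0 ∷_) (replicate-+ c)

map-if : ∀ (q : A → Bool) (x y : B) zs →
         map (λ z → if q z then x else y) zs ↭ replicate (count q zs) x ++ replicate (count (not ∘ q) zs) y
map-if q x y []       = ↭-refl
map-if q x y (z ∷ zs) with q z
... | true  = ↭-prep x (map-if q x y zs)
... | false = ↭-trans (↭-prep y (map-if q x y zs)) (↭-sym (shift y (replicate (count q zs) x) _))

unique-map⇒injective : ∀ (h : A → ℕ) {xs} → Unique (map h xs) → ∀ {x y} → x ∈ xs → y ∈ xs → h x ≡ h y → x ≡ y
unique-map⇒injective h (_ ∷ u)  (here refl) (here refl) eq = refl
unique-map⇒injective h (x≢ ∷ u) (here refl) (there y∈)  eq = contradiction eq (All.lookup x≢ (∈-map⁺ h y∈))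
unique-map⇒injective h (x≢ ∷ u) (there x∈)  (here refl) eq = contradiction (≡.sym eq) (All.lookup x≢ (∈-map⁺ h x∈))
unique-map⇒injective h (_ ∷ u)  (there x∈)  (there y∈)  eq = unique-map⇒injective h u x∈ y∈ eq

close⇒consecutive : ∀ {s t} → s ≤ suc t → t ≤ suc s → s ≢ t → Consecutive s t
close⇒consecutive {s} {t} s≤ t≤ s≢t with ℕₚ.<-cmp s t
... | tri< s<t _ _ = inj₁ (ℕₚ.≤-antisym s<t t≤)
... | tri≈ _ s≡t _ = contradiction s≡t s≢t
... | tri> _ _ t<s = inj₂ (ℕₚ.≤-antisym t<s s≤)

∑∑-rigid : ∀ (xs : List A) (ys : List B) {g h : A → B → ℚ} → (∀ {x y} → x ∈ xs → y ∈ ys → g x y Q.≤ h x y) →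
           ∑∑ xs ys h Q.≤ ∑∑ xs ys g → ∀ {x y} → x ∈ xs → y ∈ ys → g x y ≡ h x y
∑∑-rigid xs ys g≤h h≤g x∈ y∈ = ∑-rigid ys (g≤h x∈)
  (ℚₚ.≤-reflexive (≡.sym (∑-rigid xs (λ x∈ → ∑-mono ys (g≤h x∈)) h≤g x∈))) y∈

module _ {n} (G : Graph n) where

  open Growth G

  -- If v and the other endpoint lie on different sides of P, then either the edge from v to p
  -- crosses, or p is on the side of v and can replace it in the induction.
  crossing : ∀ {l} → Grown l → (P : Fin n → Bool) → ∀ {x y} → x ∈ l → y ∈ l → P x ≡ true → P y ≡ false →
             ∃ λ u → ∃ λ w → u ∈ l × w ∈ l × adj G u w ≡ true × P u ≡ true × P w ≡ false
  crossing (root v) P (here refl) (here refl) Px Py with () ← ≡.trans (≡.sym Px) Py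
  crossing (grow gr _ p∈ a) P (here refl) (here refl) Px Py with () ← ≡.trans (≡.sym Px) Py
  crossing (grow {v} {p} gr _ p∈ a) P (here refl) (there y∈) Px Py with P p in Pp
  ... | false = v , p , here refl , there p∈ , a , Px , Pp
  ... | true with u , w , u∈ , w∈ , rest ← crossing gr P p∈ y∈ Pp Py = u , w , there u∈ , there w∈ , rest
  crossing (grow {v} {p} gr _ p∈ a) P (there x∈) (here refl) Px Py with P p in Pp
  ... | true  = p , v , there p∈ , here refl , adj-sym G a , Pp , Py
  ... | false with u , w , u∈ , w∈ , rest ← crossing gr P x∈ p∈ Px Pp = u , w , there u∈ , there w∈ , rest
  crossing (grow gr _ _ _) P (there x∈) (there y∈) Px Py
    with u , w , u∈ , w∈ , rest ← crossing gr P x∈ y∈ Px Py = u , w , there u∈ , there w∈ , rest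

-- The case of equality

module _ (h : A → ℕ) {xs : List A} {e : ℕ} (σ : map h xs ↭ path-types (suc e)) where

  path-injective : ∀ {x y} → x ∈ xs → y ∈ xs → h x ≡ h y → x ≡ y
  path-injective = unique-map⇒injective h
    (SetoidPermₚ.Unique-resp-↭ (≡.setoid ℕ) (Perm.↭⇒↭ₛ (↭-sym σ))
      (Unique.map⁺ ℕₚ.suc-injective (Unique.downFrom⁺ (suc e))))

  path-range : ∀ {x} → x ∈ xs → ∃ λ i → h x ≡ suc i × i ≤ e
  path-range x∈ with i , i∈ , eq ← ∈-map⁻ suc (∈-resp-↭ σ (∈-map⁺ h x∈)) =
    i , eq , ℕ.s≤s⁻¹ (∈-downFrom⁻ i∈)

  path-surjective : ∀ {i} → i ≤ e → ∃ λ x → x ∈ xs × h x ≡ suc i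
  path-surjective i≤e
    with x , x∈ , eq ← ∈-map⁻ h (∈-resp-↭ (↭-sym σ) (∈-map⁺ suc (∈-downFrom⁺ (ℕ.s≤s i≤e)))) =
    x , x∈ , ≡.sym eq

module Attached {n} (G : Graph n) {K : List (Fin n)} {e : ℕ}
                (grown : Growth.Grown G K) (dominated : ∀ {v} → v ∉ K → ∃ λ p → p ∈ K × adj G v p ≡ true)
                (distances : ∀ {o} → o ∈ rest K → map (dist G o) K ↭ path-types (suc e))
                {o₀ : Fin n} (o₀∈ : o₀ ∈ rest K) where
  open Growth G
  open Distance G
  open Parents G K dominated

  d-injective : ∀ {o} → o ∈ O → ∀ {x y} → x ∈ K → y ∈ K → d o x ≡ d o y → x ≡ y
  d-injective {o} o∈ = path-injective (d o) (distances o∈)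

  d-range : ∀ {o} → o ∈ O → ∀ {x} → x ∈ K → ∃ λ i → d o x ≡ suc i × i ≤ e
  d-range {o} o∈ = path-range (d o) (distances o∈)

  d-surjective : ∀ {o} → o ∈ O → ∀ {i} → i ≤ e → ∃ λ x → x ∈ K × d o x ≡ suc i
  d-surjective {o} o∈ = path-surjective (d o) (distances o∈)

  -- The coordinate along K: distances from one fixed outer vertex take each of the values 1, ..., 1
  -- + e exactly once on K.
  φ : Fin n → ℕ
  φ = d o₀

  -- Since K is connected, some edge inside K leaves the set where φ is at most φ x. As φ grows by
  -- at most one along an edge and is injective on K, that edge can only join x to y.
  link : ∀ {x y} → x ∈ K → y ∈ K → φ y ≡ suc (φ x) → adj G x y ≡ true
  link {x} {y} x∈ y∈ φy
    with u , w , u∈ , w∈ , uw , Pu , Pw ← crossing G grown (λ z → does (φ z ℕ.≤? φ x)) x∈ y∈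
           (dec-true (φ x ℕ.≤? φ x) ℕₚ.≤-refl)
           (dec-false (φ y ℕ.≤? φ x) (ℕₚ.<⇒≱ (ℕₚ.≤-reflexive (≡.sym φy)))) =
    ≡.subst₂ (λ u w → adj G u w ≡ true)
      (d-injective o₀∈ u∈ x∈ (ℕₚ.≤-antisym φu≤ (ℕ.s≤s⁻¹ (ℕₚ.≤-trans φw> φw≤))))
      (d-injective o₀∈ w∈ y∈ (ℕₚ.≤-antisym (ℕₚ.≤-trans φw≤ (ℕₚ.≤-trans (ℕ.s≤s φu≤) (ℕₚ.≤-reflexive (≡.sym φy))))
                                          (ℕₚ.≤-trans (ℕₚ.≤-reflexive φy) φw>)))
      uw
    where
    φu≤ : φ u ≤ φ x
    φu≤ = holds (φ u ℕ.≤? φ x) Pu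
    φw> : suc (φ x) ≤ φ w
    φw> = ℕₚ.≰⇒> λ φw≤φx → contradiction (≡.trans (≡.sym (dec-true (φ w ℕ.≤? φ x) φw≤φx)) Pw) λ ()
    φw≤ : φ w ≤ suc (φ u)
    φw≤ = d-stepʳ o₀ (adj-sym G uw)

  d-adj≡1 : ∀ {u v} → adj G u v ≡ true → d u v ≡ 1
  d-adj≡1 uv = ℕₚ.≤-antisym (d-adj uv) (d-pos (adj⇒≢ G uv))

  -- Two neighbours of o in K would both be at distance 1, but the distances from o to K are
  -- distinct.
  only-neighbour : ∀ {o} → o ∈ O → ∀ {x} → x ∈ K → adj G o x ≡ true → x ≡ parent o
  only-neighbour o∈ x∈ ox = d-injective o∈ x∈ (parent∈ (∉-rest o∈))
    (≡.trans (d-adj≡1 ox) (≡.sym (d-adj≡1 (parent-adj (∉-rest o∈)))))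

  -- An inner path vertex has two neighbours on the path, both at distance 2 from
  -- a leaf attached to it, whereas distances from a leaf to the path are distinct.
  parent-end : ∀ {o} → o ∈ O → φ (parent o) ≡ 1 ⊎ φ (parent o) ≡ suc e
  parent-end {o} o∈ with d-range o₀∈ (parent∈ (∉-rest o∈))
  ... | zero  , φp , _   = inj₁ φp
  ... | suc i , φp , i<e with suc i ℕ.≟ e
  ...   | yes refl = inj₂ φp
  ...   | no  i≢e
    with x , x∈ , φx ← d-surjective o₀∈ (ℕₚ.≤-trans (ℕₚ.n≤1+n i) i<e)
       | y , y∈ , φy ← d-surjective o₀∈ (ℕₚ.≤∧≢⇒< i<e i≢e)
    = contradiction (≡.trans (≡.sym φx) (≡.trans (cong φ x≡y) φy)) (ℕₚ.<⇒≢ (ℕₚ.m≤n⇒m≤1+n ℕₚ.≤-refl))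
    where
    p∈ = parent∈ (∉-rest o∈)
    op = parent-adj (∉-rest o∈)
    two : ∀ {z} → z ∈ K → adj G (parent o) z ≡ true → d o z ≡ 2
    two {z} z∈ pz = ℕₚ.≤-antisym (ℕₚ.≤-trans (d-step z op) (ℕ.s≤s (d-adj pz)))
      (ℕₚ.≤∧≢⇒< (d-pos λ { refl → ∉-rest o∈ z∈ })
        (λ 1≡ → adj⇒≢ G pz (d-injective o∈ p∈ z∈ (≡.trans (d-adj≡1 op) 1≡))))
    x≡y : x ≡ y
    x≡y = d-injective o∈ x∈ y∈ (≡.trans
      (two x∈ (adj-sym G (link x∈ p∈ (≡.trans φp (cong suc (≡.sym φx))))))
      (≡.sym (two y∈ (link p∈ y∈ (≡.trans φy (cong suc (≡.sym φp)))))))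

  -- For e = 0 the two ends coincide and every outer vertex counts as left; this is why the star is
  -- matched separately.
  side : Fin n → Bool
  side o = does (φ (parent o) ℕ.≟ 1)

  side-true : ∀ {o} → side o ≡ true → φ (parent o) ≡ 1
  side-true {o} = holds (φ (parent o) ℕ.≟ 1)

  side-false : ∀ {o} → o ∈ O → side o ≡ false → φ (parent o) ≡ suc e
  side-false {o} o∈ s with parent-end o∈
  ... | inj₁ φp = contradiction (≡.trans (≡.sym (dec-true (φ (parent o) ℕ.≟ 1) φp)) s) λ ()
  ... | inj₂ φp = φp

  ℓ r : ℕ
  ℓ = count side O
  r = count (not ∘ side) O

  type : Fin n → ℕ
  type v = if does (v ∈? K) then φ v else (if side v then 0 else 2 ℕ.+ e)

  type-K : ∀ {v} → v ∈ K → type v ≡ φ v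
  type-K {v} v∈ rewrite dec-true (v ∈? K) v∈ = refl

  type-O : ∀ {v} → v ∉ K → type v ≡ (if side v then 0 else 2 ℕ.+ e)
  type-O {v} v∉ rewrite dec-false (v ∈? K) v∉ = refl

  type-≤ : ∀ v → type v ≤ 2 ℕ.+ e
  type-≤ v = by-cases (v ∈? K)
    where
    leaf-≤ : ∀ b → (if b then 0 else 2 ℕ.+ e) ≤ 2 ℕ.+ e
    leaf-≤ true  = ℕ.z≤n
    leaf-≤ false = ℕₚ.≤-refl
    by-cases : Dec (v ∈ K) → type v ≤ 2 ℕ.+ e
    by-cases (yes v∈) = let _ , φv , i≤e = d-range o₀∈ v∈ in
      subst (_≤ 2 ℕ.+ e) (≡.sym (≡.trans (type-K v∈) φv)) (ℕ.s≤s (ℕₚ.m≤n⇒m≤1+n i≤e))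
    by-cases (no  v∉) = subst (_≤ 2 ℕ.+ e) (≡.sym (type-O v∉)) (leaf-≤ (side v))

  types : map type (allFin n) ↭ path-types (suc e) ++ leaf-types e ℓ r
  types = begin
    map type (allFin n)                                                  ↭⟨ map⁺ type (split-↭ (grown-unique grown)) ⟩
    map type (K ++ O)                                                    ≡⟨ map-++ type K O ⟩
    map type K ++ map type O                                             ≡⟨ cong₂ _++_ (map-cong-∈ K type-K) (map-cong-∈ O (λ o∈ → type-O (∉-rest o∈))) ⟩
    map φ K ++ map (λ o → if side o then 0 else 2 ℕ.+ e) O               ↭⟨ ++⁺ (distances o₀∈) (map-if side 0 (2 ℕ.+ e) O) ⟩
    path-types (suc e) ++ leaf-types e ℓ r                               ∎
    where
    open Perm.PermutationReasoning

  ∈-rest : ∀ {v} → v ∉ K → v ∈ O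
  ∈-rest {v} v∉ = ∈-filter⁺ (λ v → ¬? (v ∈? K)) (∈-allFin v) v∉

  mixed⇒ : ∀ {x o} → x ∈ K → o ∉ K → adj G x o ≡ true → Consecutive (type x) (type o)
  mixed⇒ {x} {o} x∈ o∉ xo = ≡.subst₂ Consecutive (≡.sym (type-K x∈)) (≡.sym (type-O o∉)) (by-side (side o) refl)
    where
    φx : φ x ≡ φ (parent o)
    φx = cong φ (only-neighbour (∈-rest o∉) x∈ (adj-sym G xo))
    by-side : ∀ b → side o ≡ b → Consecutive (φ x) (if b then 0 else 2 ℕ.+ e)
    by-side true  s = inj₂ (≡.sym (≡.trans φx (side-true s)))
    by-side false s = inj₁ (cong suc (≡.trans φx (side-false (∈-rest o∉) s)))

  mixed⇐ : ∀ {x o} → x ∈ K → o ∉ K → Consecutive (type x) (type o) → adj G x o ≡ true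
  mixed⇐ {x} {o} x∈ o∉ con =
    adj-sym G (subst (λ p → adj G o p ≡ true)
      (≡.sym (d-injective o₀∈ x∈ (parent∈ o∉) (same-φ (side o) refl (≡.subst₂ Consecutive (type-K x∈) (type-O o∉) con)))) (parent-adj o∉))
    where
    same-φ : ∀ b → side o ≡ b → Consecutive (φ x) (if b then 0 else 2 ℕ.+ e) → φ x ≡ φ (parent o)
    same-φ true  s (inj₂ eq) = ≡.trans (≡.sym eq) (≡.sym (side-true s))
    same-φ false s (inj₁ eq) = ≡.trans (ℕₚ.suc-injective eq) (≡.sym (side-false (∈-rest o∉) s))
    same-φ false s (inj₂ eq) with i , φx , i≤e ← d-range o₀∈ x∈ =
      contradiction (subst (_≤ e) (≡.sym (ℕₚ.suc-injective (≡.trans eq φx))) i≤e) (ℕₚ.<⇒≱ (ℕₚ.m≤n⇒m≤1+n ℕₚ.≤-refl))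

  typed : (∀ {x y} → x ∈ O → y ∈ O → adj G x y ≢ true) → TypedBy G type
  typed leaves-independent u v = by-cases (u ∈? K) (v ∈? K)
    where
    by-cases : Dec (u ∈ K) → Dec (v ∈ K) →
               (adj G u v ≡ true → Consecutive (type u) (type v)) × (Consecutive (type u) (type v) → adj G u v ≡ true)
    by-cases (yes u∈) (no  v∉) = mixed⇒ u∈ v∉ , mixed⇐ u∈ v∉
    by-cases (no  u∉) (yes v∈) = consecutive-sym ∘ mixed⇒ v∈ u∉ ∘ adj-sym G , adj-sym G ∘ mixed⇐ v∈ u∉ ∘ consecutive-sym
    by-cases (yes u∈) (yes v∈) =
      (λ uv → ≡.subst₂ Consecutive (≡.sym (type-K u∈)) (≡.sym (type-K v∈))
        (close⇒consecutive (d-stepʳ o₀ uv) (d-stepʳ o₀ (adj-sym G uv)) (adj⇒≢ G uv ∘ d-injective o₀∈ u∈ v∈))) ,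
      λ con → linked (≡.subst₂ Consecutive (type-K u∈) (type-K v∈) con)
      where
      linked : Consecutive (φ u) (φ v) → adj G u v ≡ true
      linked (inj₁ eq) = link u∈ v∈ (≡.sym eq)
      linked (inj₂ eq) = adj-sym G (link v∈ u∈ (≡.sym eq))
    by-cases (no u∉) (no v∉) =
      (λ uv → contradiction uv (leaves-independent (∈-rest u∉) (∈-rest v∉))) ,
      λ con → contradiction (≡.subst₂ Consecutive (type-O u∉) (type-O v∉) con) (far-apart (side u) (side v))
      where
      far-apart : ∀ b b′ → ¬ Consecutive (if b then 0 else 2 ℕ.+ e) (if b′ then 0 else 2 ℕ.+ e)
      far-apart true  true  (inj₁ ())
      far-apart true  true  (inj₂ ())
      far-apart true  false (inj₁ ())
      far-apart true  false (inj₂ ())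
      far-apart false true  (inj₁ ())
      far-apart false true  (inj₂ ())
      far-apart false false = consecutive-irrefl refl

module Rigid {n} (G : Graph n) {K : List (Fin n)} {e c c′ : ℕ}
             (grown : Growth.Grown G K) (lengthK : length K ≡ suc e)
             (dominated : ∀ {v} → v ∉ K → ∃ λ p → p ∈ K × adj G v p ≡ true)
             (lengthO : c ℕ.+ c′ ≡ length (rest K)) (c′≤c : c′ ≤ c) (c≤1+c′ : c ≤ suc c′)
             {f : ℕ → ℚ} (f-mono : ∀ k → f k < f (suc k))
             (f-convex : ∀ k → f (suc k) + f (suc k) Q.≤ f k + f (suc (suc k)))
             (tight : bound f e c c′ Q.≤ total f G)
             {o₀ : Fin n} (o₀∈ : o₀ ∈ rest K) where
  open Growth G
  open Distance G
  open Parents G K dominated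
  open Dominated G grown lengthK dominated lengthO c′≤c c≤1+c′

  private
    f-mono′ : ∀ k → f k Q.≤ f (suc k)
    f-mono′ k = ℚₚ.<⇒≤ (f-mono k)

    L N : ℕ
    L = c ℕ.+ c′
    N = c * c′ ℕ.+ c′ * c

    X : ℚ
    X = f (2 ℕ.+ e) Q.- f 2

    inside : ∑∑ K K (value f G) + (∑∑ O K (value f G) + ∑∑ O K (value f G)) Q.≤
             ∑∑-path f (suc e) + (L · ∑-path f (suc e) + L · ∑-path f (suc e))
    inside = ℚₚ.+-mono-≤ (KK-≤ f-mono′) (ℚₚ.+-mono-≤ (OK-≤ f-mono′) (OK-≤ f-mono′))

    tight′ : bound f e c c′ Q.≤
             ∑∑ K K (value f G) + (∑∑ O K (value f G) + ∑∑ O K (value f G)) + ∑∑ O O (value f G)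
    tight′ = subst (bound f e c c′ Q.≤_) (total-split f) tight

  OO-tight : ∑∑ O O (value f G) ≡ L · (L · f 2) + N · X
  OO-tight = +-rigidʳ inside (OO-≤ f-mono′ f-convex) tight′

  OK-tight : ∑∑ O K (value f G) ≡ L · ∑-path f (suc e)
  OK-tight = +-rigidˡ (OK-≤ f-mono′) (OK-≤ f-mono′) (ℚₚ.≤-reflexive (≡.sym
    (+-rigidʳ (KK-≤ f-mono′) (ℚₚ.+-mono-≤ (OK-≤ f-mono′) (OK-≤ f-mono′))
      (ℚₚ.≤-reflexive (≡.sym (+-rigidˡ inside (OO-≤ f-mono′ f-convex) tight′))))))

  row-tight : ∀ {o} → o ∈ O → ∑ K (value f G o) ≡ ∑-path f (suc e)
  row-tight = ∑-rigid O {λ o → ∑ K (value f G o)} {λ _ → ∑-path f (suc e)} (OK-row-≤ f-mono′)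
    (ℚₚ.≤-reflexive (≡.trans (OK-const f-mono′) (≡.sym OK-tight)))

  row-tight′ : ∀ {o} → o ∈ O → ∑-path f (length K) Q.≤ ∑ K (f ∘ d o)
  row-tight′ {o} o∈ = ℚₚ.≤-reflexive (≡.trans (cong (∑-path f) lengthK)
    (≡.trans (≡.sym (row-tight o∈)) (row-value f-mono′ o∈)))

  distances : ∀ {o} → o ∈ O → map (d o) K ↭ path-types (suc e)
  distances {o} o∈ = subst (λ k → map (d o) K ↭ path-types k) lengthK
    (outer-row-rigid grown f-mono (parent∈ (∉-rest o∈)) (parent-adj (∉-rest o∈)) (row-tight′ o∈))

  open Attached G grown dominated distances o₀∈

  ℓ+r : ℓ ℕ.+ r ≡ c ℕ.+ c′
  ℓ+r = ≡.trans (count-not side O) (≡.sym lengthO)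

  private
    far : f (2 ℕ.+ e) ≡ f 2 + X
    far = Outer.f≡f2+h f f-mono′ f-convex e

    X≥0 : 0ℚ Q.≤ X
    X≥0 = Outer.h≥0 f f-mono′ f-convex e

    OO-broom : ∑∑ O O (λ x y → f 2 + separated side X x y) ≡ L · (L · f 2) + (ℓ * r ℕ.+ r * ℓ) · X
    OO-broom = ≡.trans (∑∑-separated (f 2) O side X)
      (cong (λ k → k · (k · f 2) + (ℓ * r ℕ.+ r * ℓ) · X) (≡.sym lengthO))

    ℓr≤ : ℓ * r ≤ c * c′
    ℓr≤ = proj₁ (balanced {ℓ} {r} ℓ+r c′≤c c≤1+c′)

    ℓr+rℓ≤ : ℓ * r ℕ.+ r * ℓ ≤ N
    ℓr+rℓ≤ = ℕₚ.+-mono-≤ ℓr≤ (≡.subst₂ _≤_ (ℕₚ.*-comm ℓ r) (ℕₚ.*-comm c c′) ℓr≤)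

    -- Leaves on the same side share their neighbour and are at distance at most 2; otherwise the
    -- two neighbours are at distance at most e inside K. Unlike the averaged estimate this bounds
    -- each pair, and its sum is at most the value in `OO-tight`, so every pair becomes tight.
    pair-≤ : ∀ {x y} → x ∈ O → y ∈ O → value f G x y Q.≤ f 2 + separated side X x y
    pair-≤ {x} {y} x∈ y∈ with x Fin.≟ y
    ... | yes refl = ℚₚ.≤-reflexive (≡.sym (≡.trans (cong (f 2 +_) (cong (if_then X else 0ℚ) (xor-same (side x)))) (ℚₚ.+-identityʳ (f 2))))
    ... | no _ = by-sides (side x) (side y) refl refl
      where
      xp = parent-adj (∉-rest x∈)
      yp = parent-adj (∉-rest y∈)
      near : φ (parent x) ≡ φ (parent y) → f (d x y) Q.≤ f 2 + 0ℚ
      near eq = ℚₚ.≤-trans (mono-≤ f-mono′ (ℕₚ.≤-trans (d-step y xp)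
        (ℕ.s≤s (d-adj (adj-sym G (subst (λ p → adj G y p ≡ true)
          (≡.sym (d-injective o₀∈ (parent∈ (∉-rest x∈)) (parent∈ (∉-rest y∈)) eq)) yp))))))
        (ℚₚ.≤-reflexive (≡.sym (ℚₚ.+-identityʳ (f 2))))
      apart : f (d x y) Q.≤ f 2 + X
      apart = ℚₚ.≤-trans (mono-≤ f-mono′ (ℕₚ.≤-trans (d-step y xp) (ℕ.s≤s (ℕₚ.≤-trans (d-stepʳ (parent x) yp)
        (subst (suc (d (parent x) (parent y)) ≤_) lengthK
          (d<length grown (parent∈ (∉-rest x∈)) (parent∈ (∉-rest y∈)))))))) (ℚₚ.≤-reflexive far)
      by-sides : ∀ b b′ → side x ≡ b → side y ≡ b′ → f (d x y) Q.≤ f 2 + (if b xor b′ then X else 0ℚ)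
      by-sides true  true  sx sy = near (≡.trans (side-true sx) (≡.sym (side-true sy)))
      by-sides false false sx sy = near (≡.trans (side-false x∈ sx) (≡.sym (side-false y∈ sy)))
      by-sides true  false sx sy = apart
      by-sides false true  sx sy = apart

    pair-tight : ∀ {x y} → x ∈ O → y ∈ O → value f G x y ≡ f 2 + separated side X x y
    pair-tight = ∑∑-rigid O O pair-≤ (ℚₚ.≤-trans (ℚₚ.≤-reflexive OO-broom)
      (ℚₚ.≤-trans (ℚₚ.+-monoʳ-≤ (L · (L · f 2)) (·-monoˡ-≤ X≥0 ℓr+rℓ≤)) (ℚₚ.≤-reflexive (≡.sym OO-tight))))

  -- Adjacent outer vertices would contribute at most f 1, whereas `pair-tight` forces at least f 2.
  leaves-independent : ∀ {x y} → x ∈ O → y ∈ O → adj G x y ≢ true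
  leaves-independent {x} {y} x∈ y∈ xy = <⇒≱ (ℚₚ.≤-<-trans (mono-≤ f-mono′ (d-adj xy)) (f-mono 1)) (begin
    f 2                             ≡⟨ ℚₚ.+-identityʳ (f 2) ⟨
    f 2 + 0ℚ                        ≤⟨ ℚₚ.+-monoʳ-≤ (f 2) (nonneg (side x xor side y)) ⟩
    f 2 + separated side X x y      ≡⟨ pair-tight x∈ y∈ ⟨
    value f G x y                   ≡⟨ value-≢ f G (adj⇒≢ G xy) ⟩
    f (d x y)                       ∎)
    where
    open ℚₚ.≤-Reasoning
    nonneg : ∀ b → 0ℚ Q.≤ (if b then X else 0ℚ)
    nonneg true  = X≥0
    nonneg false = ℚₚ.≤-refl

  -- For e ≠ 0 the excess X is positive, so `OO-tight` forces the number of separated pairs up to N.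
  -- For e = 0 the excess vanishes and the sums carry no information about the sides.
  sides-balanced : e ≢ 0 → ℓ ≡ c ⊎ r ≡ c
  sides-balanced e≢0 = proj₂ (balanced {ℓ} {r} ℓ+r c′≤c c≤1+c′) (ℕₚ.≮⇒≥ λ ℓr< → ℕₚ.<⇒≱
    (ℕₚ.+-mono-<-≤ ℓr< (≡.subst₂ _≤_ (ℕₚ.*-comm ℓ r) (ℕₚ.*-comm c c′) ℓr≤))
    (·-cancelʳ-≤ N (ℓ * r ℕ.+ r * ℓ) X>0 (+-cancelˡ-≤ (L · (L · f 2)) (begin
      L · (L · f 2) + N · X                               ≡⟨ OO-tight ⟨
      ∑∑ O O (value f G)                                  ≤⟨ ∑∑-mono O O pair-≤ ⟩
      ∑∑ O O (λ x y → f 2 + separated side X x y)         ≡⟨ OO-broom ⟩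
      L · (L · f 2) + (ℓ * r ℕ.+ r * ℓ) · X               ∎))))
    where
    open ℚₚ.≤-Reasoning
    +-cancelˡ-≤ : ∀ s {p q} → s + p Q.≤ s + q → p Q.≤ q
    +-cancelˡ-≤ s {p} {q} le = +-cancelʳ-≤ s (≡.subst₂ Q._≤_ (ℚₚ.+-comm s p) (ℚₚ.+-comm s q) le)
    X>0 : 0ℚ < X
    X>0 = subst (_< X) (ℚₚ.+-inverseʳ (f 2))
      (ℚₚ.+-monoˡ-< (Q.- f 2) (mono-< f-mono (ℕₚ.m<m+n 2 (ℕₚ.n≢0⇒n>0 e≢0))))

  sides-trivial : e ≡ 0 → ℓ ≡ c ℕ.+ c′ × r ≡ 0
  sides-trivial refl = ≡.trans (≡.sym (ℕₚ.+-identityʳ ℓ)) (≡.trans (cong (ℓ ℕ.+_) (≡.sym r≡0)) ℓ+r) , r≡0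
    where
    none : ∀ xs → (∀ {x} → x ∈ xs → side x ≡ true) → count (not ∘ side) xs ≡ 0
    none []       _   = refl
    none (x ∷ xs) all rewrite all (here refl) = none xs (all ∘ there)
    r≡0 : r ≡ 0
    r≡0 = none O λ {o} o∈ → dec-true (φ (parent o) ℕ.≟ 1) (Data.Sum.[ id , id ] (parent-end o∈))

double-broom-iso : ∀ {n} {G H : Graph n} e {c c′ ℓ r} {a b : Fin n → ℕ} →
  TypedBy G a → (∀ u → a u ≤ 2 ℕ.+ e) → map a (allFin n) ↭ path-types (suc e) ++ leaf-types e ℓ r →
  TypedBy H b → (∀ u → b u ≤ 2 ℕ.+ e) → map b (allFin n) ↭ path-types (suc e) ++ leaf-types e c c′ →
  ℓ ℕ.+ r ≡ c ℕ.+ c′ → (e ≢ 0 → ℓ ≡ c ⊎ r ≡ c) → (e ≡ 0 → ℓ ≡ c ℕ.+ c′ × r ≡ 0) → G ≅ H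
-- G already has all its leaves on the left, so it is the typing of H that gets collapsed.
double-broom-iso {n} {G} {H} zero {c} {c′} {a = a} {b} G-typed a≤ as H-typed b≤ bs ℓ+r _ star with refl , refl ← star refl =
  typed-iso {G = G} {H} {a} G-typed (relabel {G = H} {b} collapse collapse-consecutive collapse-consecutive⁻ b≤ H-typed)
    (↭-trans as (↭-sym (↭-trans (↭-reflexive (map-∘ (allFin n)))
      (↭-trans (map⁺ collapse bs) (↭-reflexive (collapse-types c c′))))))
double-broom-iso {n} {G} {H} (suc e) {c} {c′} {ℓ} {r} {a} {b} G-typed a≤ as H-typed b≤ bs ℓ+r sides _ with sides (λ ())
... | inj₁ refl with refl ← ℕₚ.+-cancelˡ-≡ c r c′ ℓ+r = typed-iso {G = G} {H} {a} {b} G-typed H-typed (↭-trans as (↭-sym bs))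
-- The part of size c lies on the right in G, so its typing is reflected before matching.
... | inj₂ refl with refl ← ℕₚ.+-cancelʳ-≡ c ℓ c′ (≡.trans ℓ+r (ℕₚ.+-comm c c′)) =
  typed-iso {G = G} {H} {b = b} (relabel {G = G} {a} (3 ℕ.+ e ∸_) ∸-consecutive ∸-consecutive⁻ a≤ G-typed) H-typed
    (↭-trans (↭-reflexive (map-∘ (allFin n)))
      (↭-trans (map⁺ (3 ℕ.+ e ∸_) as) (↭-trans (mirror (suc e) ℓ r) (↭-sym bs))))

-- Assembling the bound and the equality case

module Theorem (f : ℕ → ℚ) (f-mono : ∀ k → f k < f (suc k))
               (f-convex : ∀ k → f (suc k) + f (suc k) Q.≤ f k + f (suc (suc k)))
               (n α : ℕ) (G : Graph n) (connected : Connected G)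
               (S : Subset n) (independent : Independent G S) (∣S∣≡α : ∣ S ∣ ≡ α)
               (α<n : suc α ≤ n) (n≤2α : n ≤ 2 * α) where
  open Growth G

  m e c : ℕ
  m = n ∸ α
  e = 2 * m ∸ 2
  c = (n ℕ.+ 2 ∸ 2 * m) ℕ./ 2

  cov : Fin n → Bool
  cov v = not (lookup S v)

  covers : ∀ {u v} → adj G u v ≡ true → cov u ≡ false → cov v ≡ true
  covers {u} {v} uv cu with lookup S v in Sv
  ... | false = refl
  ... | true  = contradiction
    (≡.trans (≡.sym uv) (independent u v (lookup⇒[]= u S (not-injective cu)) (lookup⇒[]= v S Sv))) λ ()

  cov-size : count cov (allFin n) ≡ m
  cov-size = ≡.sym (≡.trans (cong₂ _∸_ (≡.sym size) (≡.sym (≡.trans (count-lookup S) ∣S∣≡α)))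
    (ℕₚ.m+n∸m≡n (count (lookup S) (allFin n)) (count cov (allFin n))))
    where
    size : count (lookup S) (allFin n) ℕ.+ count cov (allFin n) ≡ n
    size = ≡.trans (count-not (lookup S) (allFin n)) (length-tabulate {n = n} id)

  2+e : 2 ℕ.+ e ≡ 2 * m
  2+e = ℕₚ.m+[n∸m]≡n (ℕₚ.*-monoʳ-≤ 2 (ℕₚ.m<n⇒0<n∸m α<n))

  -- This is where α ≥ n / 2 enters, as 2m = 2n - 2α ≤ n. It leaves an outer vertex besides the 2m -
  -- 1 vertices of K, and it keeps the distances of 𝒜 within the search range of `dist`.
  fits : 2 ℕ.+ e ≤ n
  fits = begin
    2 ℕ.+ e           ≡⟨ 2+e ⟩
    2 * (n ∸ α)       ≡⟨ ℕₚ.*-distribˡ-∸ 2 n α ⟩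
    2 * n ∸ 2 * α     ≤⟨ ℕₚ.∸-monoʳ-≤ (2 * n) n≤2α ⟩
    2 * n ∸ n         ≡⟨ ℕₚ.m+n∸m≡n n (n ℕ.+ 0) ⟩
    n ℕ.+ 0           ≡⟨ ℕₚ.+-identityʳ n ⟩
    n                 ∎
    where open ℕₚ.≤-Reasoning

  Core : Set
  Core = ∃ λ K → Grown K × length K ≡ suc e × (∀ {v} → v ∉ K → ∃ λ p → p ∈ K × adj G v p ≡ true)

  core : Core
  core = Skeleton.skeleton G (λ u v → let k , r = connected u v in k , reach⇒walk G k r) cov covers
    (≡.trans 2+e (cong (2 *_) (≡.sym cov-size))) fits

  module WithCore (K : List (Fin n)) (grown : Grown K) (lengthK : length K ≡ suc e)
                  (dominated : ∀ {v} → v ∉ K → ∃ λ p → p ∈ K × adj G v p ≡ true) where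

    L : ℕ
    L = length (rest K)

    n≡ : n ≡ suc e ℕ.+ L
    n≡ = ≡.trans (length-split (grown-unique grown)) (cong (ℕ._+ L) lengthK)

    -- From n = (2m - 1) + L one gets n + 2 - 2m = L + 1, so the left leaf count of 𝒜 is L / 2
    -- rounded up.
    c≡ : suc L ℕ./ 2 ≡ c
    c≡ = cong (ℕ._/ 2) (begin
      suc L                             ≡⟨ ℕₚ.m+n∸m≡n (2 ℕ.+ e) (suc L) ⟨
      2 ℕ.+ e ℕ.+ suc L ∸ (2 ℕ.+ e)     ≡⟨ cong₂ _∸_ shuffle 2+e ⟩
      n ℕ.+ 2 ∸ 2 * m                   ∎)
      where
      open ≡.≡-Reasoning
      shuffle : 2 ℕ.+ e ℕ.+ suc L ≡ n ℕ.+ 2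
      shuffle = ≡.trans (cong (2 ℕ.+_) (≡.trans (ℕₚ.+-suc e L) (≡.sym n≡))) (ℕₚ.+-comm 2 n)

    split : ∃ λ c′ → c ℕ.+ c′ ≡ L × c′ ≤ c × c ≤ suc c′
    split = subst (λ c → ∃ λ c′ → c ℕ.+ c′ ≡ L × c′ ≤ c × c ≤ suc c′) c≡ (half L)

    c′ : ℕ
    c′ = proj₁ split

    lengthO : c ℕ.+ c′ ≡ L
    lengthO = proj₁ (proj₂ split)

    c′≤c : c′ ≤ c
    c′≤c = proj₁ (proj₂ (proj₂ split))

    c≤1+c′ : c ≤ suc c′
    c≤1+c′ = proj₂ (proj₂ (proj₂ split))

    f-mono′ : ∀ k → f k Q.≤ f (suc k)
    f-mono′ k = ℚₚ.<⇒≤ (f-mono k)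

    open Broom n m

    leafy : map τ (allFin n) ↭ path-types (suc e) ++ leaf-types e c c′
    leafy = τ-types (≡.trans n≡ (cong (suc e ℕ.+_) (≡.sym lengthO)))

    lower : bound f e c c′ Q.≤ total f (𝒜 n m)
    lower = Typed.total-≥ (𝒜 n m) {e} {c} {c′} τ (λ {u} {v} → adj⇒consecutive {u} {v}) leafy τ-≤ fits f-mono′

    upper : total f G Q.≤ bound f e c c′
    upper = Dominated.total-≤ G grown lengthK dominated lengthO c′≤c c≤1+c′ f-mono′ f-convex

    maximal : Wf f G Q.≤ Wf f (𝒜 n m)
    maximal = total-cancel-≤ f G (𝒜 n m) (ℚₚ.≤-trans upper lower)

    leaf : ∃ (_∈ rest K)
    leaf = nonempty (rest K) (ℕₚ.+-cancelˡ-≤ (suc e) 1 L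
      (≡.subst₂ _≤_ (ℕₚ.+-comm 1 (suc e)) n≡ fits))

    unique : Wf f G ≡ Wf f (𝒜 n m) → G ≅ 𝒜 n m
    unique eq = double-broom-iso {G = G} {𝒜 n m} e {c} {c′} {ℓ} {r} (typed leaves-independent) type-≤ types
      (λ u v → adj⇒consecutive {u} {v} , consecutive⇒adj {u} {v}) τ-≤ leafy ℓ+r sides-balanced sides-trivial
      where
      tight : bound f e c c′ Q.≤ total f G
      tight = ℚₚ.≤-trans lower (ℚₚ.≤-reflexive (≡.sym (total-cong f G (𝒜 n m) eq)))
      open Rigid G grown lengthK dominated lengthO c′≤c c≤1+c′ f-mono f-convex tight (proj₂ leaf)
      open Attached G grown dominated distances (proj₂ leaf)

theorem7 : (f : ℕ → ℚ) → f 0 ≡ 0ℚ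
    → (∀ k → f k < f (suc k))
    → (∀ k → f (suc k) + f (suc k) Q.≤ f k + f (suc (suc k)))
    → (n α : ℕ) (G : Graph n) → Connected G → IndependenceNumber G α
    → suc α ≤ n → n ≤ 2 * α
    → (Wf f G Q.≤ Wf f (𝒜 n (n ∸ α)))
    × ((Wf f G ≡ Wf f (𝒜 n (n ∸ α))) ⇔ (G ≅ 𝒜 n (n ∸ α)))
theorem7 f _ f-mono f-convex n α G connected ((S , independent , ∣S∣≡α) , _) α<n n≤2α =
  let K , grown , lengthK , dominated = core
      open WithCore K grown lengthK dominated
  in maximal , mk⇔ unique λ (φ , φ-adj) → Isomorphism.Wf-iso G (𝒜 n m) φ φ-adj f
  where open Theorem f f-mono f-convex n α G connected S independent ∣S∣≡α α<n n≤2α
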